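{- The Maximum Weight Independent Set of Rectangles problem (MWISR) can be solved in time $O(n^4)$ for instances with $n$ axis-parallel rectangles in which each rectangle contains a point $(x,y)$ such that no point $(x,y')$ with $y'>y$ is part of a rectangle of the instance.
   Context: MWISR: given a collection of $n$ weighted axis-parallel rectangles in the plane $\mathbb R^2$, find a maximum total weight subset of rectangles that are pairwise compatible. Writing $(x_1,y_1,x_2,y_2)$ for the axis-parallel rectangle with upper left point $(x_1,y_1)$ and lower right point $(x_2,y_2)$, two rectangles $(x_1,y_1,x_2,y_2)$ and $(x'_1,y'_1,x'_2,y'_2)$ are compatible if they do not overlap (do not share an internal point), i.e. at least one of $x_2\le x'_1$, $x'_2\le x_1$, $y_1\le y'_2$, $y'_1\le y_2$ holds. -}

module Defs where

open import Algebra.Bundles using (CommutativeRing)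
import Algebra.Properties.CommutativeMonoid.Sum as Sum
open import Data.Bool using (Bool; true; false; if_then_else_; _∧_; not)
open import Data.Fin using (Fin; fromℕ<; toℕ)
open import Data.Fin.Subset using (Subset; _∈_)
open import Data.Nat using (ℕ; zero; suc; _+_; _∸_; _*_; _≤_; _<?_; _≤ᵇ_; _≡ᵇ_)
open import Data.Product using (_×_; ∃-syntax)
open import Data.Sum using (_⊎_)
open import Data.Vec using (lookup; tabulate)
open import Data.Vec.Functional using (Vector)
open import Level using (Level; _⊔_) renaming (suc to lsuc)
open import Relation.Binary.Core using (Rel)
open import Relation.Binary.Structures using (IsDecTotalOrder)
import Relation.Binary.Construct.NonStrictToStrict as ToStrict
open import Relation.Binary.PropositionalEquality using (_≡_; _≢_)
open import Relation.Nullary using (¬_; yes; no; does)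

-- The library has no real numbers.  Coordinates and weights range over an
-- arbitrary ordered field with decidable order; classically ℝ is one, and
-- the decidable order is the unit-cost comparison of the real RAM.
record OrderedField (c ℓ₁ ℓ₂ : Level) : Set (lsuc (c ⊔ ℓ₁ ⊔ ℓ₂)) where
  field
    commutativeRing : CommutativeRing c ℓ₁
  open CommutativeRing commutativeRing public
    renaming (_+_ to _+ᶠ_; _*_ to _*ᶠ_; _-_ to _-ᶠ_; -_ to -ᶠ_)
    using (Carrier; _≈_; 0#; 1#; +-commutativeMonoid)
  infix 4 _≤ᶠ_ _<ᶠ_
  field
    _≤ᶠ_            : Rel Carrier ℓ₂
    isDecTotalOrder : IsDecTotalOrder _≈_ _≤ᶠ_
    0≉1             : ¬ (0# ≈ 1#)
    inverse         : ∀ x → ¬ (x ≈ 0#) → ∃[ y ] (x *ᶠ y) ≈ 1#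
    +-mono          : ∀ {x y} z → x ≤ᶠ y → (x +ᶠ z) ≤ᶠ (y +ᶠ z)
    *-nonneg        : ∀ {x y} → 0# ≤ᶠ x → 0# ≤ᶠ y → 0# ≤ᶠ (x *ᶠ y)
  open IsDecTotalOrder isDecTotalOrder public using () renaming (_≤?_ to _≤ᶠ?_)

  _<ᶠ_ : Rel Carrier (ℓ₁ ⊔ ℓ₂)
  _<ᶠ_ = ToStrict._<_ _≈_ _≤ᶠ_

-- A uniform-cost random access machine with structured control flow.
-- Memory consists of integer arrays and of scalar arrays, each named by a
-- numeral of the program text and indexed by ℕ.  Integers support only
-- constants, addition, truncated subtraction and comparison; scalars addition,
-- subtraction and comparison.  In particular there is no multiplication,
-- and scalars cannot be converted to integers.

data IntExpr : Set where
  const    : ℕ → IntExpr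
  intAt    : (array : ℕ) (index : IntExpr) → IntExpr
  _⊕_ _⊖_  : IntExpr → IntExpr → IntExpr

data ScalarExpr : Set where
  scalarAt   : (array : ℕ) (index : IntExpr) → ScalarExpr
  _⊞_ _⊟_    : ScalarExpr → ScalarExpr → ScalarExpr

data Test : Set where
  _≤ⁱ_ : IntExpr → IntExpr → Test
  _≤ˢ_ : ScalarExpr → ScalarExpr → Test

data Program : Set where
  skip        : Program
  setInt      : (array : ℕ) (index : IntExpr) (value : IntExpr) → Program
  setScalar   : (array : ℕ) (index : IntExpr) (value : ScalarExpr) → Program
  _⨟_         : Program → Program → Program
  cond        : Test → Program → Program → Program
  while       : Test → Program → Program

infixr 5 _⨟_
infixl 6 _⊕_ _⊖_ _⊞_ _⊟_
infix  4 _≤ⁱ_ _≤ˢ_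

-- One unit for each constant, memory access, operation and comparison.

intCost : IntExpr → ℕ
intCost (const k)   = 1
intCost (intAt a i) = 1 + intCost i
intCost (d ⊕ e)     = 1 + intCost d + intCost e
intCost (d ⊖ e)     = 1 + intCost d + intCost e

scalarCost : ScalarExpr → ℕ
scalarCost (scalarAt a i) = 1 + intCost i
scalarCost (d ⊞ e)        = 1 + scalarCost d + scalarCost e
scalarCost (d ⊟ e)        = 1 + scalarCost d + scalarCost e

testCost : Test → ℕ
testCost (d ≤ⁱ e) = 1 + intCost d + intCost e
testCost (d ≤ˢ e) = 1 + scalarCost d + scalarCost e

write : ∀ {a} {A : Set a} → (ℕ → ℕ → A) → ℕ → ℕ → A → (ℕ → ℕ → A)
write m a i v b j = if (a ≡ᵇ b) ∧ (i ≡ᵇ j) then v else m b j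

module Machine {c ℓ₁ ℓ₂} (F : OrderedField c ℓ₁ ℓ₂) where
  open OrderedField F

  record State : Set c where
    constructor ⟨_,_⟩
    field
      ints    : ℕ → ℕ → ℕ
      scalars : ℕ → ℕ → Carrier
  open State public

  evalInt : IntExpr → State → ℕ
  evalInt (const k)   s = k
  evalInt (intAt a i) s = ints s a (evalInt i s)
  evalInt (d ⊕ e)     s = evalInt d s + evalInt e s
  evalInt (d ⊖ e)     s = evalInt d s ∸ evalInt e s

  evalScalar : ScalarExpr → State → Carrier
  evalScalar (scalarAt a i) s = scalars s a (evalInt i s)
  evalScalar (d ⊞ e)        s = evalScalar d s +ᶠ evalScalar e s
  evalScalar (d ⊟ e)        s = evalScalar d s -ᶠ evalScalar e s

  evalTest : Test → State → Bool
  evalTest (d ≤ⁱ e) s = evalInt d s ≤ᵇ evalInt e s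
  evalTest (d ≤ˢ e) s = does (evalScalar d s ≤ᶠ? evalScalar e s)

  -- Run p s t s′: started in s, program p halts in s′ after t time units.
  data Run : Program → State → ℕ → State → Set c where
    run-skip : ∀ {s} → Run skip s 1 s
    run-setInt : ∀ {a i e s} →
      Run (setInt a i e) s (1 + intCost i + intCost e)
          ⟨ write (ints s) a (evalInt i s) (evalInt e s) , scalars s ⟩
    run-setScalar : ∀ {a i e s} →
      Run (setScalar a i e) s (1 + intCost i + scalarCost e)
          ⟨ ints s , write (scalars s) a (evalInt i s) (evalScalar e s) ⟩
    run-⨟ : ∀ {p q s s′ s″ t u} →
      Run p s t s′ → Run q s′ u s″ → Run (p ⨟ q) s (t + u) s″
    run-if-true : ∀ {b p q s s′ t} → evalTest b s ≡ true →
      Run p s t s′ → Run (cond b p q) s (1 + testCost b + t) s′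
    run-if-false : ∀ {b p q s s′ t} → evalTest b s ≡ false →
      Run q s t s′ → Run (cond b p q) s (1 + testCost b + t) s′
    run-while-true : ∀ {b p s s′ s″ t u} → evalTest b s ≡ true →
      Run p s t s′ → Run (while b p) s′ u s″ →
      Run (while b p) s (1 + testCost b + t + u) s″
    run-while-false : ∀ {b p s} → evalTest b s ≡ false →
      Run (while b p) s (1 + testCost b) s

infix 4 _∈O_

_∈O_ : (ℕ → ℕ) → (ℕ → ℕ) → Set
f ∈O g = ∃[ k ] ∃[ n₀ ] (∀ n → n₀ ≤ n → f n ≤ k * g n)

module MWISR {c ℓ₁ ℓ₂} (F : OrderedField c ℓ₁ ℓ₂) where
  open OrderedField F
  open Machine F

  -- (x₁ , y₁) is the upper left and (x₂ , y₂) the lower right point.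
  record WeightedRectangle : Set (c ⊔ ℓ₁ ⊔ ℓ₂) where
    field
      x₁ y₁ x₂ y₂ : Carrier
      x₁<x₂       : x₁ <ᶠ x₂
      y₂<y₁       : y₂ <ᶠ y₁
      weight      : Carrier
  open WeightedRectangle public

  -- Indexed by Fin n, so a rectangle may occur several times.
  Instance : ℕ → Set (c ⊔ ℓ₁ ⊔ ℓ₂)
  Instance n = Vector WeightedRectangle n

  -- Rectangles are closed: an open one has no topmost point on any vertical.
  Contains : WeightedRectangle → Carrier → Carrier → Set ℓ₂
  Contains r x y = (x₁ r ≤ᶠ x × x ≤ᶠ x₂ r) × (y₂ r ≤ᶠ y × y ≤ᶠ y₁ r)

  Compatible : WeightedRectangle → WeightedRectangle → Set ℓ₂
  Compatible r r′ =
    x₂ r ≤ᶠ x₁ r′ ⊎ x₂ r′ ≤ᶠ x₁ r ⊎ y₁ r ≤ᶠ y₂ r′ ⊎ y₁ r′ ≤ᶠ y₂ r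

  module _ {n : ℕ} (I : Instance n) where

    EachVisibleFromAbove : Set (c ⊔ ℓ₁ ⊔ ℓ₂)
    EachVisibleFromAbove = ∀ i → ∃[ x ] ∃[ y ]
      Contains (I i) x y × (∀ y′ → y <ᶠ y′ → ∀ j → ¬ Contains (I j) x y′)

    Independent : Subset n → Set ℓ₂
    Independent S = ∀ i j → i ∈ S → j ∈ S → i ≢ j → Compatible (I i) (I j)

    totalWeight : Subset n → Carrier
    totalWeight S = Sum.sum +-commutativeMonoid
      (λ i → if lookup S i then weight (I i) else 0#)

    record IsMaxWeightIndependent (S : Subset n) : Set ℓ₂ where
      field
        independent : Independent S
        maximal     : ∀ S′ → Independent S′ → totalWeight S′ ≤ᶠ totalWeight S

    -- Input: n in cell 0 of integer array 0; x₁, y₁, x₂, y₂ and the weight of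
    -- rectangle i in cell i of scalar arrays 0, 1, 2, 3, 4; zero elsewhere.
    inputInts : ℕ → ℕ → ℕ
    inputInts zero    zero    = n
    inputInts zero    (suc _) = 0
    inputInts (suc _) _       = 0

    column : (WeightedRectangle → Carrier) → ℕ → Carrier
    column f i with i <? n
    ... | yes i<n = f (I (fromℕ< i<n))
    ... | no  _   = 0#

    inputScalars : ℕ → ℕ → Carrier
    inputScalars 0 = column x₁
    inputScalars 1 = column y₁
    inputScalars 2 = column x₂
    inputScalars 3 = column y₂
    inputScalars 4 = column weight
    inputScalars _ = λ _ → 0#

    input : State
    input = ⟨ inputInts , inputScalars ⟩

  -- Rectangle i is selected iff cell i of integer array 1 is nonzero.
  output : ∀ n → State → Subset n
  output n s = tabulate (λ i → not (ints s 1 (toℕ i) ≡ᵇ 0))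

  SolvesWithin : Program → ∀ {n} → Instance n → ℕ → Set (c ⊔ ℓ₂)
  SolvesWithin p {n} I T = ∃[ t ] ∃[ s ]
    Run p (input I) t s × t ≤ T × IsMaxWeightIndependent I (output n s)

{-# OPTIONS --safe #-}
module Submission where

-- A visible rectangle i has an anchor: an abscissa aᵢ in its range which lies in
-- the interior of the range of no rectangle with a higher top, and which can be
-- taken to be x₁ i or some x₂ j.  In an independent set let l have the lowest
-- bottom.  Every other member is left of l, right of l or above l, and the
-- anchor separates those above l, so the members other than l split into those
-- ending at or before aₗ and those starting at or after aₗ.  Conversely any two
-- independent sets taken from the two sides of l are compatible.
--
-- Hence, for boundaries k and m, let C(k,m) be the set of rectangles right of k
-- (or right of the anchor of k and above k), symmetrically left of m, and with
-- bottoms not below those of k and m.  The optimum over C(k,m) satisfies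
-- f(k,m) = max (0 , max over l ∈ C(k,m) of f(k,l) + w(l) + f(l,m)).  Instead of
-- ordering the O(n²) pairs, all of them are updated in n rounds: after t rounds
-- f(k,m) bounds the weight of all sets of at most t rectangles.  A round costs
-- O(n) per pair, including the copying of the sets attaining the values.

open import Algebra.Bundles using (CommutativeRing)
import Algebra.Properties.CommutativeMonoid.Sum as Sum
open import Data.Bool using (Bool; true; false; _∨_) renaming (if_then_else_ to ifᵇ_then_else_)
open import Data.Bool.Properties using (∨-conicalˡ; ∨-conicalʳ)
open import Data.Fin using (Fin; zero; suc; toℕ; fromℕ<; combine)
open import Data.Fin.Properties using (toℕ<n; toℕ-injective; toℕ-combine; combine-injective; toℕ-fromℕ<; fromℕ<-toℕ; punchInᵢ≢i) renaming (_≟_ to _≟ꟳ_)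
open import Data.Fin.Subset using (Subset; _∈_; _∉_; ∣_∣; ⁅_⁆; Nonempty)
open import Data.Fin.Subset.Properties using (_∈?_; nonempty?; Empty-unique; ∣⊥∣≡0; p⊂q⇒∣p∣<∣q∣; p⊆q⇒∣p∣≤∣q∣; ∣⁅x⁆∣≡1; ∣p∣≤n; x∈⁅x⁆; x∈⁅y⁆⇒x≡y)
import Data.List.Extrema as Extrema
open import Data.List using (List; map; filter; allFin)
import Data.List.Membership.Propositional as List
open import Data.List.Membership.Propositional.Properties using (∈-allFin; ∈-filter⁺; ∈-map⁺; ∈-map⁻)
import Data.List.Relation.Unary.All as All
import Data.List.Relation.Unary.All.Properties as All
open import Data.Nat using (ℕ; zero; suc; _+_; _∸_; _*_; _^_; _⊔_; _≤_; _<_; _≡ᵇ_; _≤?_; _<?_; _≟_; z≤n; s≤s; NonZero; >-nonZero)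
open import Data.Nat.Properties
open import Data.Product using (_×_; _,_; proj₁; proj₂; ∃-syntax) renaming (map to map-×)
open import Data.Sum using (_⊎_; inj₁; inj₂; [_,_]′)
open import Data.Unit.Polymorphic using (⊤; tt)
open import Data.Vec using (lookup; tabulate)
open import Data.Vec.Functional using (Vector)
open import Data.Vec.Properties using ([]=⇒lookup; lookup⇒[]=; lookup∘tabulate; tabulate-cong)
open import Function using (_∘_; id)
open import Level using (Lift; lift; lower) renaming (_⊔_ to _⊔ℓ_)
open import Relation.Binary.Bundles using (DecTotalOrder)
open import Relation.Binary.PropositionalEquality using (_≡_; _≢_; refl; sym; trans; cong; cong₂; subst; subst₂; module ≡-Reasoning)
open import Relation.Nullary using (¬_; Dec; yes; no; does; contradiction)
open import Relation.Nullary.Decidable using (dec-true; dec-false; _×-dec_; _⊎-dec_; ¬?; map′)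
open import Defs

-- Commands with bounded loops

data Cond : Set where
  test       : Test → Cond
  _and_ _or_ : Cond → Cond → Cond
  neg        : Cond → Cond

infixr 3 _and_
infixr 2 _or_

-- Short-circuit evaluation by duplicating branches: the program text grows, but each test is
-- evaluated at most once, so `condCost` just adds up the tests.
branch : Cond → Program → Program → Program
branch (test b)  p q = cond b p q
branch (φ and ψ) p q = branch φ (branch ψ p q) q
branch (φ or ψ)  p q = branch φ p (branch ψ p q)
branch (neg φ)   p q = branch φ q p

condCost : Cond → ℕ
condCost (test b)  = 1 + testCost b
condCost (φ and ψ) = condCost φ + condCost ψ
condCost (φ or ψ)  = condCost φ + condCost ψ
condCost (neg φ)   = condCost φ

data Cmd : Set where
  nop           : Cmd
  _[_]≔_        : ℕ → IntExpr → IntExpr → Cmd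
  _[_]≔ˢ_       : ℕ → IntExpr → ScalarExpr → Cmd
  _⨾_           : Cmd → Cmd → Cmd
  if_then_else_ : Cond → Cmd → Cmd → Cmd
  for           : (v δ : ℕ) → Cmd → Cmd

infixr 5 _⨾_
infix 6 _[_]≔_ _[_]≔ˢ_

var : ℕ → IntExpr
var v = intAt v (const 0)

-- The body of for v δ runs for the values 0, …, δ + n - 1 of variable v,
-- where n is the size of the input.
compile : Cmd → Program
compile nop                    = skip
compile (a [ i ]≔ e)           = setInt a i e
compile (a [ i ]≔ˢ e)          = setScalar a i e
compile (c ⨾ d)                = compile c ⨟ compile d
compile (if φ then c else d)   = branch φ (compile c) (compile d)
compile (for v δ c)            =
  setInt v (const 0) (const 0) ⨟
  while (var v ⊕ const 1 ≤ⁱ const δ ⊕ var 0)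
    (compile c ⨟ setInt v (const 0) (var v ⊕ const 1))

-- An upper bound: a conditional is charged for both branches. In a loop, 3 pays for the
-- initialisation, 16 for a successful guard (10) and the increment (6), the last 10 for the failing
-- guard.
time : Cmd → ℕ → ℕ
time nop                  n = 1
time (a [ i ]≔ e)         n = 1 + intCost i + intCost e
time (a [ i ]≔ˢ e)        n = 1 + intCost i + scalarCost e
time (c ⨾ d)              n = time c n + time d n
time (if φ then c else d) n = condCost φ + (time c n + time d n)
time (for v δ c)          n = 3 + ((δ + n) * (16 + time c n) + 10)

-- Running times as polynomials whose degree is the loop nesting depth

depth : Cmd → ℕ
depth nop                  = 0
depth (a [ i ]≔ e)         = 0
depth (a [ i ]≔ˢ e)        = 0
depth (c ⨾ d)              = depth c ⊔ depth d
depth (if φ then c else d) = depth c ⊔ depth d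
depth (for v δ c)          = suc (depth c)

factor : Cmd → ℕ
factor nop                  = 1
factor (a [ i ]≔ e)         = 1 + intCost i + intCost e
factor (a [ i ]≔ˢ e)        = 1 + intCost i + scalarCost e
factor (c ⨾ d)              = factor c + factor d
factor (if φ then c else d) = condCost φ + (factor c + factor d)
factor (for v δ c)          = 3 + ((δ + 1) * (16 + factor c) + 10)

module _ (n : ℕ) .{{_ : NonZero n}} where
  open ≤-Reasoning

  private
    power-mono : ∀ {d e} k → d ≤ e → k * n ^ d ≤ k * n ^ e
    power-mono k d≤e = *-monoʳ-≤ k (^-monoʳ-≤ n d≤e)

    const-≤ : ∀ k d → k ≤ k * n ^ d
    const-≤ k d = begin
      k         ≡⟨ *-identityʳ k ⟨
      k * n ^ 0 ≤⟨ power-mono {0} {d} k z≤n ⟩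
      k * n ^ d ∎

    sum-≤ : ∀ k l d {x y} → x ≤ k * n ^ d → y ≤ l * n ^ d → x + y ≤ (k + l) * n ^ d
    sum-≤ k l d {x} {y} x≤ y≤ = begin
      x + y                     ≤⟨ +-mono-≤ x≤ y≤ ⟩
      k * n ^ d + l * n ^ d     ≡⟨ *-distribʳ-+ (n ^ d) k l ⟨
      (k + l) * n ^ d           ∎

  -- Since `n` is positive, lower powers are absorbed by higher ones and `δ + n` is at most
  -- `(δ + 1) * n`, so each loop contributes one factor `n`.
  time-≤ : ∀ c → time c n ≤ factor c * n ^ depth c
  time-≤ nop            = const-≤ 1 0
  time-≤ (a [ i ]≔ e)   = const-≤ (1 + intCost i + intCost e) 0
  time-≤ (a [ i ]≔ˢ e)  = const-≤ (1 + intCost i + scalarCost e) 0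
  time-≤ (c ⨾ d)        = sum-≤ (factor c) (factor d) (depth c ⊔ depth d)
    (≤-trans (time-≤ c) (power-mono (factor c) (m≤m⊔n (depth c) (depth d))))
    (≤-trans (time-≤ d) (power-mono (factor d) (m≤n⊔m (depth c) (depth d))))
  time-≤ (if φ then c else d) = sum-≤ (condCost φ) (factor c + factor d) (depth c ⊔ depth d)
    (const-≤ (condCost φ) (depth c ⊔ depth d)) (sum-≤ (factor c) (factor d) (depth c ⊔ depth d)
    (≤-trans (time-≤ c) (power-mono (factor c) (m≤m⊔n (depth c) (depth d))))
    (≤-trans (time-≤ d) (power-mono (factor d) (m≤n⊔m (depth c) (depth d)))))
  time-≤ (for v δ c) = sum-≤ 3 ((δ + 1) * (16 + factor c) + 10) (suc e) (const-≤ 3 (suc e))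
    (sum-≤ ((δ + 1) * (16 + factor c)) 10 (suc e) iterations (const-≤ 10 (suc e)))
    where
    e = depth c
    body-≤ : 16 + time c n ≤ (16 + factor c) * n ^ e
    body-≤ = sum-≤ 16 (factor c) e (const-≤ 16 e) (time-≤ c)
    count-≤ : δ + n ≤ (δ + 1) * n
    count-≤ = begin
      δ + n          ≤⟨ +-monoˡ-≤ n (m≤m*n δ n) ⟩
      δ * n + n      ≡⟨ cong (δ * n +_) (*-identityˡ n) ⟨
      δ * n + 1 * n  ≡⟨ *-distribʳ-+ n δ 1 ⟨
      (δ + 1) * n    ∎
    iterations : (δ + n) * (16 + time c n) ≤ (δ + 1) * (16 + factor c) * n ^ suc e
    iterations = begin
      (δ + n) * (16 + time c n)                       ≤⟨ *-mono-≤ count-≤ body-≤ ⟩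
      (δ + 1) * n * ((16 + factor c) * n ^ e)         ≡⟨ [m*n]*[o*p]≡[m*o]*[n*p] (δ + 1) n (16 + factor c) (n ^ e) ⟩
      (δ + 1) * (16 + factor c) * n ^ suc e           ∎

time∈O : ∀ c → time c ∈O (_^ depth c)
time∈O c = factor c , 1 , λ n 1≤n → time-≤ n {{>-nonZero 1≤n}} c

-- Syntactic write sets and memory updates

writesInt writesScalar : Cmd → ℕ → Bool
writesInt nop                  b = false
writesInt (a [ i ]≔ e)         b = a ≡ᵇ b
writesInt (a [ i ]≔ˢ e)        b = false
writesInt (c ⨾ d)              b = writesInt c b ∨ writesInt d b
writesInt (if φ then c else d) b = writesInt c b ∨ writesInt d b
writesInt (for v δ c)          b = (v ≡ᵇ b) ∨ writesInt c b

writesScalar nop                  b = false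
writesScalar (a [ i ]≔ e)         b = false
writesScalar (a [ i ]≔ˢ e)        b = a ≡ᵇ b
writesScalar (c ⨾ d)              b = writesScalar c b ∨ writesScalar d b
writesScalar (if φ then c else d) b = writesScalar c b ∨ writesScalar d b
writesScalar (for v δ c)          b = writesScalar c b

≡ᵇ-refl : ∀ a → (a ≡ᵇ a) ≡ true
≡ᵇ-refl zero    = refl
≡ᵇ-refl (suc a) = ≡ᵇ-refl a

≢⇒≡ᵇ-false : ∀ {a b} → a ≢ b → (a ≡ᵇ b) ≡ false
≢⇒≡ᵇ-false {a} {b} a≢b = dec-false (a ≟ b) a≢b

module _ {ℓ} {A : Set ℓ} (m : ℕ → ℕ → A) where

  write-same : ∀ a {i j v} → i ≡ j → write m a i v a j ≡ v
  write-same a {i} refl rewrite ≡ᵇ-refl a | ≡ᵇ-refl i = refl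

  write-other : ∀ a {i j v} → i ≢ j → write m a i v a j ≡ m a j
  write-other a {i} {j} i≢j rewrite ≡ᵇ-refl a | ≢⇒≡ᵇ-false i≢j = refl

  write-array : ∀ a {b} i v j → (a ≡ᵇ b) ≡ false → write m a i v b j ≡ m b j
  write-array a i v j a≠b rewrite a≠b = refl

-- A program logic for total correctness with time bounds

module Logic {ℓ₀ ℓ₁ ℓ₂} (F : OrderedField ℓ₀ ℓ₁ ℓ₂) where
  open OrderedField F using (_≤ᶠ_; _≤ᶠ?_)
  open Machine F

  Holds : Cond → State → Set ℓ₂
  Holds (test (d ≤ⁱ e)) s = Lift ℓ₂ (evalInt d s ≤ evalInt e s)
  Holds (test (d ≤ˢ e)) s = evalScalar d s ≤ᶠ evalScalar e s
  Holds (φ and ψ)       s = Holds φ s × Holds ψ s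
  Holds (φ or ψ)        s = Holds φ s ⊎ Holds ψ s
  Holds (neg φ)         s = ¬ Holds φ s

  holds? : ∀ φ s → Dec (Holds φ s)
  holds? (test (d ≤ⁱ e)) s = map′ lift lower (evalInt d s ≤? evalInt e s)
  holds? (test (d ≤ˢ e)) s = evalScalar d s ≤ᶠ? evalScalar e s
  holds? (φ and ψ)       s = holds? φ s ×-dec holds? ψ s
  holds? (φ or ψ)        s = holds? φ s ⊎-dec holds? ψ s
  holds? (neg φ)         s = ¬? (holds? φ s)

  evalTest-does : ∀ b s → evalTest b s ≡ does (holds? (test b) s)
  evalTest-does (d ≤ⁱ e) s = refl
  evalTest-does (d ≤ˢ e) s = refl

  mutual
    -- Negation exchanges the two branches, hence the mutual recursion. The time `u` is only
    -- bounded, because short-circuit evaluation may skip tests.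
    run-branch-true : ∀ φ {p q s s′ t} → Holds φ s → Run p s t s′ →
      ∃[ u ] u ≤ condCost φ × Run (branch φ p q) s (u + t) s′
    run-branch-true (test b) {s = s} h r =
      _ , ≤-refl , run-if-true (trans (evalTest-does b s) (dec-true (holds? (test b) s) h)) r
    run-branch-true (φ and ψ) (hφ , hψ) r =
      join (run-branch-true ψ hψ r) (run-branch-true φ hφ)
    run-branch-true (φ or ψ) {s = s} h r with holds? φ s | h
    ... | yes hφ | _       = weaken (condCost ψ) (run-branch-true φ hφ r)
    ... | no ¬hφ | inj₁ hφ = contradiction hφ ¬hφ
    ... | no ¬hφ | inj₂ hψ = join (run-branch-true ψ hψ r) (run-branch-false φ ¬hφ)
    run-branch-true (neg φ) h r = run-branch-false φ h r

    run-branch-false : ∀ φ {p q s s′ t} → ¬ Holds φ s → Run q s t s′ →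
      ∃[ u ] u ≤ condCost φ × Run (branch φ p q) s (u + t) s′
    run-branch-false (test b) {s = s} ¬h r =
      _ , ≤-refl , run-if-false (trans (evalTest-does b s) (dec-false (holds? (test b) s) ¬h)) r
    run-branch-false (φ and ψ) {s = s} ¬h r with holds? φ s
    ... | yes hφ = join (run-branch-false ψ (λ hψ → ¬h (hφ , hψ)) r) (run-branch-true φ hφ)
    ... | no ¬hφ = weaken (condCost ψ) (run-branch-false φ ¬hφ r)
    run-branch-false (φ or ψ) ¬h r =
      join (run-branch-false ψ (λ h → ¬h (inj₂ h)) r) (run-branch-false φ (λ h → ¬h (inj₁ h)))
    run-branch-false (neg φ) {s = s} ¬¬h r with holds? φ s
    ... | yes h = run-branch-true φ h r
    ... | no ¬h = contradiction ¬h ¬¬h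

    private
      weaken : ∀ {p s s′ t k} l → (∃[ u ] u ≤ k × Run p s (u + t) s′) →
        ∃[ u ] u ≤ k + l × Run p s (u + t) s′
      weaken l (u , u≤k , r) = u , ≤-trans u≤k (m≤m+n _ l) , r

      join : ∀ {p q s s′ t k l} → (∃[ u ] u ≤ l × Run q s (u + t) s′) →
        (∀ {x} → Run q s x s′ → ∃[ u ] u ≤ k × Run p s (u + x) s′) →
        ∃[ u ] u ≤ k + l × Run p s (u + t) s′
      join {p} {s = s} {s′} {t} (u , u≤l , r) f with f r
      ... | v , v≤k , r′ =
        v + u , +-mono-≤ v≤k u≤l , subst (λ x → Run p s x s′) (sym (+-assoc v u t)) r′

  -- The write sets are Boolean functions of the program text, so for a concrete command and array
  -- the premises hold by `refl`.
  record Frame (c : Cmd) (s s′ : State) : Set ℓ₀ where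
    field
      same-int    : ∀ b → writesInt c b ≡ false → ∀ j → ints s′ b j ≡ ints s b j
      same-scalar : ∀ b → writesScalar c b ≡ false → ∀ j → scalars s′ b j ≡ scalars s b j
  open Frame public

  setVar : ℕ → ℕ → State → State
  setVar v x s = ⟨ write (ints s) v 0 x , scalars s ⟩

  module Size (n : ℕ) where

    -- A total-correctness triple with a time bound. Relations between initial and final state are
    -- expressed by letting `Q` mention `s`; what is merely preserved comes from the frame.
    record Ends {ℓ} (c : Cmd) (s : State) (Q : State → Set ℓ) : Set (ℓ₀ ⊔ℓ ℓ) where
      constructor ends
      field
        {steps} : ℕ
        {final} : State
        run     : Run (compile c) s steps final
        bound   : steps ≤ time c n
        frame   : Frame c s final
        post    : Q final
    open Ends public

    module _ {ℓ} {Q : State → Set ℓ} where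

      nop-ends : ∀ {s} → Q s → Ends nop s Q
      nop-ends q = ends run-skip ≤-refl
        (record { same-int = λ _ _ _ → refl ; same-scalar = λ _ _ _ → refl }) q

      int-ends : ∀ {a i e s} →
        Q ⟨ write (ints s) a (evalInt i s) (evalInt e s) , scalars s ⟩ → Ends (a [ i ]≔ e) s Q
      int-ends {a} {i} {s = s} q = ends run-setInt ≤-refl
        (record { same-int = λ b a≠b j → write-array (ints s) a (evalInt i s) _ j a≠b
                ; same-scalar = λ _ _ _ → refl }) q

      scalar-ends : ∀ {a i e s} →
        Q ⟨ ints s , write (scalars s) a (evalInt i s) (evalScalar e s) ⟩ → Ends (a [ i ]≔ˢ e) s Q
      scalar-ends {a} {i} {s = s} q = ends run-setScalar ≤-refl
        (record { same-int = λ _ _ _ → refl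
                ; same-scalar = λ b a≠b j → write-array (scalars s) a (evalInt i s) _ j a≠b }) q

      infixr 4 _andThen_ _implies_

      _andThen_ : ∀ {ℓ′ c d s} {P : State → Set ℓ′} → Ends c s P →
        (∀ {s′} → Frame c s s′ → P s′ → Ends d s′ Q) → Ends (c ⨾ d) s Q
      _andThen_ {c = c} {d} (ends r b f p) next with next f p
      ... | ends r′ b′ f′ q = ends (run-⨟ r r′) (+-mono-≤ b b′)
        (record { same-int = λ x e j → trans (same-int f′ x (∨-conicalʳ (writesInt c x) _ e) j)
                                             (same-int f x (∨-conicalˡ _ _ e) j)
                ; same-scalar = λ x e j → trans (same-scalar f′ x (∨-conicalʳ (writesScalar c x) _ e) j)
                                                (same-scalar f x (∨-conicalˡ _ _ e) j) }) q

      _implies_ : ∀ {ℓ′ c s} {P : State → Set ℓ′} → Ends c s P →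
        (∀ {s′} → Frame c s s′ → P s′ → Q s′) → Ends c s Q
      ends r b f p implies h = ends r b f (h f p)

      if-ends : ∀ {φ c d s} → (Holds φ s → Ends c s Q) → (¬ Holds φ s → Ends d s Q) →
        Ends (if φ then c else d) s Q
      if-ends {φ} {c} {d} {s} yes-case no-case with holds? φ s
      ... | yes h with yes-case h
      ...   | ends r b f q with run-branch-true φ h r
      ...     | u , u≤ , r′ = ends r′ (+-mono-≤ u≤ (≤-trans b (m≤m+n _ _)))
        (record { same-int = λ x e j → same-int f x (∨-conicalˡ _ _ e) j
                ; same-scalar = λ x e j → same-scalar f x (∨-conicalˡ _ _ e) j }) q
      if-ends {φ} {c} {d} {s} yes-case no-case | no ¬h with no-case ¬h
      ...   | ends r b f q with run-branch-false φ ¬h r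
      ...     | u , u≤ , r′ = ends r′ (+-mono-≤ u≤ (≤-trans b (m≤n+m _ _)))
        (record { same-int = λ x e j → same-int f x (∨-conicalʳ (writesInt c x) _ e) j
                ; same-scalar = λ x e j → same-scalar f x (∨-conicalʳ (writesScalar c x) _ e) j }) q

    -- The limit is read from array 0 and the counter from `v`, so the body may write neither. The
    -- step receives a frame relative to the state before the loop, which carries facts about `s`
    -- into every iteration without putting them into `Inv`.
    for-ends : ∀ {ℓ v δ c s} (Inv : ℕ → State → Set ℓ) → ints s 0 0 ≡ n →
      (v ≡ᵇ 0) ≡ false → writesInt c 0 ≡ false → writesInt c v ≡ false →
      (∀ {i x s′} → Inv i s′ → Inv i (setVar v x s′)) →
      Inv 0 s →
      (∀ (i : Fin (δ + n)) {s′} → Frame (for v δ c) s s′ → ints s′ v 0 ≡ toℕ i →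
        Inv (toℕ i) s′ → Ends c s′ (Inv (suc (toℕ i)))) →
      Ends (for v δ c) s (Inv (δ + n))
    for-ends {v = v} {δ} {c} {s} Inv size v≠0 c∌0 c∌v stable initial step =
      case-loop (loop (δ + n) 0 refl start-frame (write-same (ints s) v refl) (stable initial))
      where
      Loop = while (var v ⊕ const 1 ≤ⁱ const δ ⊕ var 0)
               (compile c ⨟ setInt v (const 0) (var v ⊕ const 1))

      set-frame : ∀ {s′} x → Frame (for v δ c) s s′ → Frame (for v δ c) s (setVar v x s′)
      set-frame {s′} x f = record
        { same-int = λ b e j → trans (write-array (ints s′) v 0 x j (∨-conicalˡ _ _ e)) (same-int f b e j)
        ; same-scalar = same-scalar f }

      start-frame : Frame (for v δ c) s (setVar v 0 s)
      start-frame = set-frame 0 (record { same-int = λ _ _ _ → refl ; same-scalar = λ _ _ _ → refl })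

      size-kept : ∀ {s′} → Frame (for v δ c) s s′ → ints s′ 0 0 ≡ n
      size-kept f = trans (same-int f 0 (trans (cong (_∨ writesInt c 0) v≠0) c∌0) 0) size

      -- Induction on the number `j` of remaining iterations, with `i` the current counter.
      loop : ∀ j i {s′} → i + j ≡ δ + n → Frame (for v δ c) s s′ → ints s′ v 0 ≡ i → Inv i s′ →
        ∃[ t ] ∃[ s″ ] Run Loop s′ t s″ × t ≤ j * (16 + time c n) + 10 ×
                       Frame (for v δ c) s s″ × Inv (δ + n) s″
      loop zero i {s′} i≡ f v≡i inv =
        _ , s′ , run-while-false (dec-false (_ ≤? _) past) , ≤-refl , f ,
        subst (λ k → Inv k s′) (trans (sym (+-identityʳ i)) i≡) inv
        where
        past : ¬ (ints s′ v 0 + 1 ≤ δ + ints s′ 0 0)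
        past le rewrite v≡i | size-kept f | sym i≡ | +-identityʳ i | +-comm i 1 = 1+n≰n le
      loop (suc j) i {s′} i≡ f v≡i inv with step (fromℕ< i<) f (trans v≡i (sym (toℕ-fromℕ< i<)))
                                              (subst (λ k → Inv k s′) (sym (toℕ-fromℕ< i<)) inv)
        where
        i< : i < δ + n
        i< = subst (i <_) i≡ (m<m+n i (s≤s z≤n))
      ... | ends {t} {s″} r b g q with loop j (suc i) (trans (sym (+-suc i j)) i≡)
                (set-frame _ f′) v≡1+i (stable (subst (λ k → Inv (suc k) s″) (toℕ-fromℕ< _) q))
        where
        f′ : Frame (for v δ c) s s″
        f′ = record
          { same-int = λ b e k → trans (same-int g b (∨-conicalʳ (v ≡ᵇ b) _ e) k) (same-int f b e k)
          ; same-scalar = λ b e k → trans (same-scalar g b e k) (same-scalar f b e k) }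
        v≡1+i : ints (setVar v (ints s″ v 0 + 1) s″) v 0 ≡ suc i
        v≡1+i = trans (write-same (ints s″) v refl)
          (trans (cong (_+ 1) (trans (same-int g v c∌v 0) v≡i)) (+-comm i 1))
      ...   | u , s‴ , r′ , u≤ , f″ , inv′ =
        _ , s‴ , run-while-true (dec-true (_ ≤? _) more) (run-⨟ r run-setInt) r′ , total , f″ , inv′
        where
        open ≤-Reasoning
        more : ints s′ v 0 + 1 ≤ δ + ints s′ 0 0
        more = begin
          ints s′ v 0 + 1   ≡⟨ cong (_+ 1) v≡i ⟩
          i + 1             ≤⟨ +-monoʳ-≤ i (s≤s z≤n) ⟩
          i + suc j         ≡⟨ i≡ ⟩
          δ + n             ≡⟨ cong (δ +_) (size-kept f) ⟨
          δ + ints s′ 0 0   ∎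
        total : 10 + (t + 6) + u ≤ (16 + time c n) + j * (16 + time c n) + 10
        total = begin
          10 + (t + 6) + u                                     ≡⟨ cong (λ x → 10 + x + u) (+-comm t 6) ⟩
          16 + t + u                                           ≤⟨ +-mono-≤ (+-monoʳ-≤ 16 b) u≤ ⟩
          16 + time c n + (j * (16 + time c n) + 10)           ≡⟨ +-assoc (16 + time c n) _ 10 ⟨
          16 + time c n + j * (16 + time c n) + 10             ∎

      case-loop : (∃[ t ] ∃[ s″ ] Run Loop (setVar v 0 s) t s″ ×
                    t ≤ (δ + n) * (16 + time c n) + 10 ×
                    Frame (for v δ c) s s″ × Inv (δ + n) s″) →
                  Ends (for v δ c) s (Inv (δ + n))
      case-loop (t , s″ , r , t≤ , f , inv) = ends (run-⨟ run-setInt r) (+-monoʳ-≤ 3 t≤) f inv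

-- Independent sets of visible rectangles

module _ {n : ℕ} where

  subset : ∀ {ℓ} {P : Fin n → Set ℓ} → (∀ i → Dec (P i)) → Subset n
  subset P? = tabulate (does ∘ P?)

  ∈-subset⁺ : ∀ {ℓ} {P : Fin n → Set ℓ} (P? : ∀ i → Dec (P i)) {i} → P i → i ∈ subset P?
  ∈-subset⁺ P? {i} p = lookup⇒[]= i _ (trans (lookup∘tabulate (does ∘ P?) i) (dec-true (P? i) p))

  ∈-subset⁻ : ∀ {ℓ} {P : Fin n → Set ℓ} (P? : ∀ i → Dec (P i)) {i} → i ∈ subset P? → P i
  ∈-subset⁻ P? {i} i∈ with P? i | trans (sym (lookup∘tabulate (does ∘ P?) i)) ([]=⇒lookup i∈)
  ... | yes p | _ = p
  ... | no _  | ()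

  IsJoin : Fin n → (A B S : Subset n) → Set
  IsJoin l A B S = ∀ i → (i ∈ S → i ≡ l ⊎ i ∈ A ⊎ i ∈ B) × (i ≡ l ⊎ i ∈ A ⊎ i ∈ B → i ∈ S)

-- Order and finite sums in an ordered field

module Order {ℓ₀ ℓ₁ ℓ₂} (F : OrderedField ℓ₀ ℓ₁ ℓ₂) where
  open OrderedField F public
  open MWISR F public

  decTotalOrder : DecTotalOrder ℓ₀ ℓ₁ ℓ₂
  decTotalOrder = record { isDecTotalOrder = isDecTotalOrder }

  open DecTotalOrder decTotalOrder public using (totalOrder; module Eq; antisym; total)
    renaming (refl to ≤ᶠ-refl; trans to ≤ᶠ-trans; reflexive to ≤ᶠ-reflexive)

  <⇒≱ᶠ : ∀ {x y} → x <ᶠ y → ¬ (y ≤ᶠ x)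
  <⇒≱ᶠ (x≤y , x≉y) y≤x = x≉y (antisym x≤y y≤x)

  ≰⇒≥ᶠ : ∀ {x y} → ¬ (x ≤ᶠ y) → y ≤ᶠ x
  ≰⇒≥ᶠ {x} {y} x≰y = [ (λ x≤y → contradiction x≤y x≰y) , id ]′ (total x y)

  ≰⇒>ᶠ : ∀ {x y} → ¬ (x ≤ᶠ y) → y <ᶠ x
  ≰⇒>ᶠ x≰y = ≰⇒≥ᶠ x≰y , λ y≈x → x≰y (≤ᶠ-reflexive (Eq.sym y≈x))

  open CommutativeRing commutativeRing using () public
    renaming (+-cong to +ᶠ-cong; +-congʳ to +ᶠ-congʳ; +-comm to +ᶠ-comm; +-identityˡ to +ᶠ-identityˡ; +-identityʳ to +ᶠ-identityʳ)

  +ᶠ-mono-≤ : ∀ {x y u v} → x ≤ᶠ y → u ≤ᶠ v → x +ᶠ u ≤ᶠ y +ᶠ v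
  +ᶠ-mono-≤ {x} {y} {u} {v} x≤y u≤v = ≤ᶠ-trans (+-mono u x≤y)
    (≤ᶠ-trans (≤ᶠ-reflexive (+ᶠ-comm y u)) (≤ᶠ-trans (+-mono y u≤v) (≤ᶠ-reflexive (+ᶠ-comm v y))))

  open Sum +-commutativeMonoid using (sum; sum-remove; sum-cong-≋; sum-replicate-zero; ∑-distrib-+)

  sum-zero : ∀ {n} {t : Vector Carrier n} → (∀ i → t i ≈ 0#) → sum t ≈ 0#
  sum-zero {n} t≈0 = Eq.trans (sum-cong-≋ t≈0) (sum-replicate-zero n)

  sum-single : ∀ {n} (t : Vector Carrier n) l → (∀ i → i ≢ l → t i ≈ 0#) → sum t ≈ t l
  sum-single {suc n} t l t≈0 = Eq.trans (sum-remove t)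
    (Eq.trans (+ᶠ-cong Eq.refl (sum-zero (λ i → t≈0 _ (punchInᵢ≢i l i)))) (+ᶠ-identityʳ (t l)))

  module _ {n : ℕ} (I : Instance n) where

    private
      term : Subset n → Fin n → Carrier
      term S i = ifᵇ lookup S i then weight (I i) else 0#

      term-∈ : ∀ {S i} → i ∈ S → term S i ≡ weight (I i)
      term-∈ i∈S rewrite []=⇒lookup i∈S = refl

      term-∉ : ∀ {S i} → i ∉ S → term S i ≡ 0#
      term-∉ {S} {i} i∉S with lookup S i in eq
      ... | true  = contradiction (lookup⇒[]= i S eq) i∉S
      ... | false = refl

      0+0 : ∀ {x y} → x ≡ 0# → y ≡ 0# → x +ᶠ y ≈ 0#
      0+0 refl refl = +ᶠ-identityˡ 0#

    -- `IsJoin` alone allows overlaps. With disjointness, the summands of `S` are pointwise those of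
    -- `A`, of the singleton and of `B`, and the sum distributes.
    weight-join : ∀ {l A B S} → IsJoin l A B S → l ∉ A → l ∉ B → (∀ {i} → i ∈ A → i ∉ B) →
      totalWeight I S ≈ totalWeight I A +ᶠ weight (I l) +ᶠ totalWeight I B
    weight-join {l} {A} {B} {S} join l∉A l∉B disjoint =
      Eq.trans (sum-cong-≋ pointwise)
        (Eq.trans (∑-distrib-+ (λ i → term A i +ᶠ term ⁅ l ⁆ i) (term B))
          (+ᶠ-congʳ (Eq.trans (∑-distrib-+ (term A) (term ⁅ l ⁆)) (+ᶠ-cong Eq.refl single))))
      where
      outside : ∀ {i} → i ≢ l → i ∉ ⁅ l ⁆
      outside i≢l i∈ = i≢l (x∈⁅y⁆⇒x≡y l i∈)

      single : sum (term ⁅ l ⁆) ≈ weight (I l)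
      single = Eq.trans (sum-single (term ⁅ l ⁆) l (λ i i≢l → Eq.reflexive (term-∉ (outside i≢l))))
                        (Eq.reflexive (term-∈ (x∈⁅x⁆ l)))

      pointwise : ∀ i → term S i ≈ term A i +ᶠ term ⁅ l ⁆ i +ᶠ term B i
      pointwise i with i ≟ꟳ l | i ∈? A | i ∈? B
      ... | yes refl | _ | _ rewrite term-∈ (proj₂ (join l) (inj₁ refl)) | term-∉ l∉A | term-∉ l∉B
                                   | term-∈ (x∈⁅x⁆ l) =
        Eq.sym (Eq.trans (+ᶠ-identityʳ _) (+ᶠ-identityˡ _))
      ... | no i≢l | yes i∈A | _ rewrite term-∈ (proj₂ (join i) (inj₂ (inj₁ i∈A))) | term-∈ i∈A
                                       | term-∉ (disjoint i∈A) | term-∉ (outside i≢l) =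
        Eq.sym (Eq.trans (+ᶠ-identityʳ _) (+ᶠ-identityʳ _))
      ... | no i≢l | no i∉A | yes i∈B rewrite term-∈ (proj₂ (join i) (inj₂ (inj₂ i∈B))) | term-∉ i∉A
                                            | term-∈ i∈B | term-∉ (outside i≢l) =
        Eq.sym (Eq.trans (+ᶠ-congʳ (+ᶠ-identityʳ _)) (+ᶠ-identityˡ _))
      ... | no i≢l | no i∉A | no i∉B rewrite term-∉ i∉A | term-∉ i∉B | term-∉ (outside i≢l)
                                           | term-∉ {S} {i} (λ i∈S → [ i≢l , [ i∉A , i∉B ]′ ]′ (proj₁ (join i) i∈S)) =
        Eq.sym (Eq.trans (+ᶠ-identityʳ _) (+ᶠ-identityʳ _))

    weight-empty : ∀ {S} → (∀ i → i ∉ S) → totalWeight I S ≈ 0#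
    weight-empty ∉S = sum-zero (λ i → Eq.reflexive (term-∉ (∉S i)))

    -- Anchors of visible rectangles

    Clear : Fin n → Carrier → Fin n → Set ℓ₂
    Clear i p j = y₁ (I j) ≤ᶠ y₁ (I i) ⊎ (p ≤ᶠ x₁ (I j) ⊎ x₂ (I j) ≤ᶠ p)

    IsAnchor : Fin n → Carrier → Set ℓ₂
    IsAnchor i p = (∀ j → Clear i p j) × x₁ (I i) ≤ᶠ p × p ≤ᶠ x₂ (I i)

    -- Moving a visible point left to the nearest of x₁ i and all x₂ j enters the
    -- interior of no further range, and makes its abscissa one of the inputs.
    anchor-exists : EachVisibleFromAbove I → ∀ i →
      IsAnchor i (x₁ (I i)) ⊎ (∃[ c ] IsAnchor i (x₂ (I c)))
    anchor-exists visible i with visible i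
    ... | x , y , ((x₁≤x , x≤x₂) , (_ , y≤y₁)) , above = selected (argmax-sel id (x₁ (I i)) ends)
      where
      open Extrema totalOrder

      ends : List Carrier
      ends = map (x₂ ∘ I) (filter (λ j → x₂ (I j) ≤ᶠ? x) (allFin n))

      p : Carrier
      p = max (x₁ (I i)) ends

      p≤x : p ≤ᶠ x
      p≤x = max≤v⁺ x₁≤x (All.map⁺ (All.all-filter (λ j → x₂ (I j) ≤ᶠ? x) (allFin n)))

      clear : ∀ j → Clear i p j
      clear j with y₁ (I j) ≤ᶠ? y₁ (I i) | x₂ (I j) ≤ᶠ? x | x ≤ᶠ? x₁ (I j)
      ... | yes lower | _ | _ = inj₁ lower
      ... | no _ | yes x₂≤x | _ = inj₂ (inj₂ (All.lookup (xs≤max (x₁ (I i)) ends)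
              (∈-map⁺ (x₂ ∘ I) (∈-filter⁺ (λ j → x₂ (I j) ≤ᶠ? x) (∈-allFin j) x₂≤x))))
      ... | no _ | no _ | yes x≤x₁ = inj₂ (inj₁ (≤ᶠ-trans p≤x x≤x₁))
      -- Here `x` is in the range of `j`, and the top of `j` is above that of `i`, hence above `y`;
      -- the point of `j` at `x` on its top edge contradicts visibility.
      ... | no higher | no x₂≰x | no x≰x₁ = contradiction
              ((≰⇒≥ᶠ x≰x₁ , ≰⇒≥ᶠ x₂≰x) , (proj₁ (y₂<y₁ (I j)) , ≤ᶠ-refl))
              (above (y₁ (I j)) (≰⇒>ᶠ (λ y₁≤y → higher (≤ᶠ-trans y₁≤y y≤y₁))) j)

      anchor : IsAnchor i p
      anchor = clear , ⊥≤max (x₁ (I i)) ends , ≤ᶠ-trans p≤x x≤x₂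

      selected : p ≡ x₁ (I i) ⊎ p List.∈ ends →
                 IsAnchor i (x₁ (I i)) ⊎ (∃[ c ] IsAnchor i (x₂ (I c)))
      selected (inj₁ p≡) = inj₁ (subst (IsAnchor i) p≡ anchor)
      selected (inj₂ p∈) with ∈-map⁻ (x₂ ∘ I) p∈
      ... | c , _ , p≡ = inj₂ (c , subst (IsAnchor i) p≡ anchor)

    -- Splitting independent sets at a lowest rectangle

    module Splitting (a : Fin n → Carrier) (anchored : ∀ i → IsAnchor i (a i)) where

      -- Index zero stands for an absent boundary.
      Left Right : Fin (suc n) → Fin n → Set ℓ₂
      Left zero    i = ⊤
      Left (suc k) i = (x₂ (I k) ≤ᶠ x₁ (I i) × y₂ (I k) ≤ᶠ y₂ (I i)) ⊎
                       (a k ≤ᶠ x₁ (I i) × y₁ (I k) ≤ᶠ y₂ (I i))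
      Right zero    i = ⊤
      Right (suc m) i = (x₂ (I i) ≤ᶠ x₁ (I m) × y₂ (I m) ≤ᶠ y₂ (I i)) ⊎
                        (x₂ (I i) ≤ᶠ a m × y₁ (I m) ≤ᶠ y₂ (I i))

      left? : ∀ k i → Dec (Left k i)
      left? zero    i = yes tt
      left? (suc k) i = ((_ ≤ᶠ? _) ×-dec (_ ≤ᶠ? _)) ⊎-dec ((_ ≤ᶠ? _) ×-dec (_ ≤ᶠ? _))

      right? : ∀ k i → Dec (Right k i)
      right? zero    i = yes tt
      right? (suc k) i = ((_ ≤ᶠ? _) ×-dec (_ ≤ᶠ? _)) ⊎-dec ((_ ≤ᶠ? _) ×-dec (_ ≤ᶠ? _))

      x₁≤a : ∀ i → x₁ (I i) ≤ᶠ a i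
      x₁≤a i = proj₁ (proj₂ (anchored i))

      a≤x₂ : ∀ i → a i ≤ᶠ x₂ (I i)
      a≤x₂ i = proj₂ (proj₂ (anchored i))

      -- The common content of both alternatives: the anchor is at or before the right end of `l`,
      -- and a bottom not below the top of `l` is not below its bottom either.
      left-beyond : ∀ {l i} → Left (suc l) i → a l ≤ᶠ x₁ (I i) × y₂ (I l) ≤ᶠ y₂ (I i)
      left-beyond {l} (inj₁ (x , y)) = ≤ᶠ-trans (a≤x₂ l) x , y
      left-beyond {l} (inj₂ (x , y)) = x , ≤ᶠ-trans (proj₁ (y₂<y₁ (I l))) y

      right-beyond : ∀ {l i} → Right (suc l) i → x₂ (I i) ≤ᶠ a l × y₂ (I l) ≤ᶠ y₂ (I i)
      right-beyond {l} (inj₁ (x , y)) = ≤ᶠ-trans x (x₁≤a l) , y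
      right-beyond {l} (inj₂ (x , y)) = x , ≤ᶠ-trans (proj₁ (y₂<y₁ (I l))) y

      left-compatible : ∀ {l i} → Left (suc l) i → Compatible (I l) (I i)
      left-compatible (inj₁ (x , _)) = inj₁ x
      left-compatible (inj₂ (_ , y)) = inj₂ (inj₂ (inj₁ y))

      right-compatible : ∀ {l i} → Right (suc l) i → Compatible (I l) (I i)
      right-compatible (inj₁ (x , _)) = inj₂ (inj₁ x)
      right-compatible (inj₂ (_ , y)) = inj₂ (inj₂ (inj₁ y))

      -- Rectangles are nondegenerate. This shows that no rectangle lies on either side of itself.
      self-incompatible : ∀ {l} → ¬ Compatible (I l) (I l)
      self-incompatible {l} (inj₁ x)               = <⇒≱ᶠ (x₁<x₂ (I l)) x
      self-incompatible {l} (inj₂ (inj₁ x))        = <⇒≱ᶠ (x₁<x₂ (I l)) x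
      self-incompatible {l} (inj₂ (inj₂ (inj₁ y))) = <⇒≱ᶠ (y₂<y₁ (I l)) y
      self-incompatible {l} (inj₂ (inj₂ (inj₂ y))) = <⇒≱ᶠ (y₂<y₁ (I l)) y

      -- The anchor of `l` is not left of `x₁ (I l)`, so `i` starts no earlier than `l` does; the
      -- conditions on bottoms chain likewise.
      left-trans : ∀ {k l i} → Left k l → Left (suc l) i → Left k i
      left-trans {zero}  _ _ = tt
      left-trans {suc k} {l} kl li with left-beyond li
      left-trans {suc k} {l} (inj₁ (x , y)) li | x′ , y′ =
        inj₁ (≤ᶠ-trans x (≤ᶠ-trans (x₁≤a l) x′) , ≤ᶠ-trans y y′)
      left-trans {suc k} {l} (inj₂ (x , y)) li | x′ , y′ =
        inj₂ (≤ᶠ-trans x (≤ᶠ-trans (x₁≤a l) x′) , ≤ᶠ-trans y y′)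

      right-trans : ∀ {k l i} → Right k l → Right (suc l) i → Right k i
      right-trans {zero}  _ _ = tt
      right-trans {suc k} {l} kl li with right-beyond li
      right-trans {suc k} {l} (inj₁ (x , y)) li | x′ , y′ =
        inj₁ (≤ᶠ-trans (≤ᶠ-trans x′ (a≤x₂ l)) x , ≤ᶠ-trans y y′)
      right-trans {suc k} {l} (inj₂ (x , y)) li | x′ , y′ =
        inj₂ (≤ᶠ-trans (≤ᶠ-trans x′ (a≤x₂ l)) x , ≤ᶠ-trans y y′)

      -- Only the case of `i` above `l` uses the anchor: the top of `i` is then higher than that of
      -- `l`, so the anchor is not interior to the range of `i`. The case of `i` below `l`
      -- contradicts the choice of `l`.
      lowest-separates : ∀ {l i} → Compatible (I l) (I i) → y₂ (I l) ≤ᶠ y₂ (I i) →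
        Right (suc l) i ⊎ Left (suc l) i
      lowest-separates (inj₁ x) lowest = inj₂ (inj₁ (x , lowest))
      lowest-separates (inj₂ (inj₁ x)) lowest = inj₁ (inj₁ (x , lowest))
      lowest-separates {l} {i} (inj₂ (inj₂ (inj₁ above))) lowest with proj₁ (anchored l) i
      ... | inj₁ y₁≤        = contradiction (≤ᶠ-trans y₁≤ above) (<⇒≱ᶠ (y₂<y₁ (I i)))
      ... | inj₂ (inj₁ a≤x₁) = inj₂ (inj₂ (a≤x₁ , above))
      ... | inj₂ (inj₂ x₂≤a) = inj₁ (inj₂ (x₂≤a , above))
      lowest-separates {l} {i} (inj₂ (inj₂ (inj₂ below))) lowest =
        contradiction (≤ᶠ-trans below lowest) (<⇒≱ᶠ (y₂<y₁ (I i)))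

      Within : Fin (suc n) → Fin (suc n) → Subset n → Set ℓ₂
      Within k m S = ∀ {i} → i ∈ S → Left k i × Right m i

      record Feasible (k m : Fin (suc n)) (S : Subset n) (v : Carrier) : Set (ℓ₁ ⊔ℓ ℓ₂) where
        field
          within      : Within k m S
          independent : Independent I S
          weighs      : totalWeight I S ≈ v
      open Feasible public

      swap : ∀ {i j} → Compatible (I i) (I j) → Compatible (I j) (I i)
      swap (inj₁ x)               = inj₂ (inj₁ x)
      swap (inj₂ (inj₁ x))        = inj₁ x
      swap (inj₂ (inj₂ (inj₁ y))) = inj₂ (inj₂ (inj₂ y))
      swap (inj₂ (inj₂ (inj₂ y))) = inj₂ (inj₂ (inj₁ y))

      -- Members of `A` end at or before the anchor of `l`, members of `B` start at or after it;
      -- this gives both the compatibility of the two sides and their disjointness.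
      feasible-join : ∀ {k m l A B S u v} → Left k l → Right m l →
        Feasible k (suc l) A u → Feasible (suc l) m B v → IsJoin l A B S →
        Feasible k m S (u +ᶠ weight (I l) +ᶠ v)
      feasible-join {k} {m} {l} {A} {B} {S} kl ml feasA feasB join = record
        { within = λ i∈S → inside (proj₁ (join _) i∈S)
        ; independent = λ i j i∈S j∈S → compat (proj₁ (join i) i∈S) (proj₁ (join j) j∈S)
        ; weighs = Eq.trans (weight-join join (λ l∈A → self-incompatible (right-compatible (rightA l∈A)))
            (λ l∈B → self-incompatible (left-compatible (leftB l∈B)))
            (λ {i} i∈A i∈B → <⇒≱ᶠ (x₁<x₂ (I i)) (across i∈A i∈B)))
            (+ᶠ-cong (+ᶠ-congʳ (weighs feasA)) (weighs feasB)) }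
        where
        rightA : ∀ {i} → i ∈ A → Right (suc l) i
        rightA i∈A = proj₂ (within feasA i∈A)

        leftB : ∀ {i} → i ∈ B → Left (suc l) i
        leftB i∈B = proj₁ (within feasB i∈B)

        across : ∀ {i j} → i ∈ A → j ∈ B → x₂ (I i) ≤ᶠ x₁ (I j)
        across i∈A j∈B = ≤ᶠ-trans (proj₁ (right-beyond (rightA i∈A))) (proj₁ (left-beyond (leftB j∈B)))

        inside : ∀ {i} → i ≡ l ⊎ i ∈ A ⊎ i ∈ B → Left k i × Right m i
        inside (inj₁ refl)       = kl , ml
        inside (inj₂ (inj₁ i∈A)) = proj₁ (within feasA i∈A) , right-trans ml (rightA i∈A)
        inside (inj₂ (inj₂ i∈B)) = left-trans kl (leftB i∈B) , proj₂ (within feasB i∈B)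

        compat : ∀ {i j} → i ≡ l ⊎ i ∈ A ⊎ i ∈ B → j ≡ l ⊎ j ∈ A ⊎ j ∈ B → i ≢ j →
          Compatible (I i) (I j)
        compat (inj₁ refl)       (inj₁ refl)       i≢j = contradiction refl i≢j
        compat (inj₁ refl)       (inj₂ (inj₁ j∈A)) _   = right-compatible (rightA j∈A)
        compat (inj₁ refl)       (inj₂ (inj₂ j∈B)) _   = left-compatible (leftB j∈B)
        compat (inj₂ (inj₁ i∈A)) (inj₁ refl)       _   = swap (right-compatible (rightA i∈A))
        compat (inj₂ (inj₂ i∈B)) (inj₁ refl)       _   = swap (left-compatible (leftB i∈B))
        compat (inj₂ (inj₁ i∈A)) (inj₂ (inj₁ j∈A)) i≢j = independent feasA _ _ i∈A j∈A i≢j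
        compat (inj₂ (inj₂ i∈B)) (inj₂ (inj₂ j∈B)) i≢j = independent feasB _ _ i∈B j∈B i≢j
        compat (inj₂ (inj₁ i∈A)) (inj₂ (inj₂ j∈B)) _   = inj₁ (across i∈A j∈B)
        compat (inj₂ (inj₂ i∈B)) (inj₂ (inj₁ j∈A)) _   = inj₂ (inj₁ (across j∈A i∈B))

      -- Limiting the cardinality by `t` replaces a recursion over pairs of boundaries by induction
      -- on `t`.
      Bounds : ℕ → Fin (suc n) → Fin (suc n) → Carrier → Set ℓ₂
      Bounds t k m v = ∀ S → Within k m S → Independent I S → ∣ S ∣ ≤ t → totalWeight I S ≤ᶠ v

      lowest : ∀ {S} → Nonempty S → ∃[ l ] l ∈ S × (∀ {i} → i ∈ S → y₂ (I l) ≤ᶠ y₂ (I i))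
      lowest {S} (i₀ , i₀∈S) = l , argmin-all (y₂ ∘ I) {P = _∈ S} i₀∈S (All.all-filter (_∈? S) (allFin n)) ,
        λ {i} i∈S → All.lookup (f[argmin]≤f[xs] {f = y₂ ∘ I} i₀ members) (∈-filter⁺ (_∈? S) (∈-allFin i) i∈S)
        where
        open Extrema totalOrder
        members = filter (_∈? S) (allFin n)
        l = argmin (y₂ ∘ I) i₀ members

      -- `V` is the table before an update and `v` the new value at `(k , m)`. The two sides of the
      -- lowest member `l` both lack `l`, so they have at most `t` members and `V` bounds them.
      bounds-step : ∀ {t k m v} (V : Fin (suc n) → Fin (suc n) → Carrier) →
        (∀ k m → Bounds t k m (V k m)) → V k m ≤ᶠ v →
        (∀ l → Left k l → Right m l → V k (suc l) +ᶠ weight (I l) +ᶠ V (suc l) m ≤ᶠ v) →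
        Bounds (suc t) k m v
      bounds-step {t} {k} {m} V bounded V≤v step S within ind size with nonempty? S
      -- The empty set has no lowest member; it is bounded by the old value.
      ... | no empty = ≤ᶠ-trans (bounded k m S within ind
              (subst (_≤ t) (sym (trans (cong ∣_∣ (Empty-unique empty)) (∣⊥∣≡0 n))) z≤n)) V≤v
      ... | yes nonempty with lowest nonempty
      ... | l , l∈S , l-lowest = ≤ᶠ-trans (≤ᶠ-reflexive (weight-join join l∉A l∉B disjoint))
              (≤ᶠ-trans (+ᶠ-mono-≤ (+-mono _ weighA) weighB)
                (step l (proj₁ (within l∈S)) (proj₂ (within l∈S))))
        where
        inA? : ∀ i → Dec (i ∈ S × Right (suc l) i)
        inA? i = (i ∈? S) ×-dec right? (suc l) i
        inB? : ∀ i → Dec (i ∈ S × Left (suc l) i)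
        inB? i = (i ∈? S) ×-dec left? (suc l) i
        A = subset inA?
        B = subset inB?

        l∉A : l ∉ A
        l∉A l∈A = self-incompatible (right-compatible (proj₂ (∈-subset⁻ inA? l∈A)))
        l∉B : l ∉ B
        l∉B l∈B = self-incompatible (left-compatible (proj₂ (∈-subset⁻ inB? l∈B)))

        disjoint : ∀ {i} → i ∈ A → i ∉ B
        disjoint {i} i∈A i∈B = <⇒≱ᶠ (x₁<x₂ (I i))
          (≤ᶠ-trans (proj₁ (right-beyond (proj₂ (∈-subset⁻ inA? i∈A))))
                    (proj₁ (left-beyond (proj₂ (∈-subset⁻ inB? i∈B)))))

        join : IsJoin l A B S
        join i = separate , [ (λ i≡l → subst (_∈ S) (sym i≡l) l∈S) ,
                   [ proj₁ ∘ ∈-subset⁻ inA? , proj₁ ∘ ∈-subset⁻ inB? ]′ ]′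
          where
          separate : i ∈ S → i ≡ l ⊎ i ∈ A ⊎ i ∈ B
          separate i∈S with i ≟ꟳ l
          ... | yes i≡l = inj₁ i≡l
          ... | no i≢l with lowest-separates (ind l i l∈S i∈S (i≢l ∘ sym)) (l-lowest i∈S)
          ...   | inj₁ r = inj₂ (inj₁ (∈-subset⁺ inA? (i∈S , r)))
          ...   | inj₂ r = inj₂ (inj₂ (∈-subset⁺ inB? (i∈S , r)))

        smaller : ∀ {C} → (∀ {i} → i ∈ C → i ∈ S) → l ∉ C → ∣ C ∣ ≤ t
        smaller C⊆S l∉C = ≤-pred (≤-trans (p⊂q⇒∣p∣<∣q∣ (C⊆S , l , l∈S , l∉C)) size)

        part : ∀ {C k m} → (∀ {i} → i ∈ C → i ∈ S) → l ∉ C → Within k m C → totalWeight I C ≤ᶠ V k m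
        part C⊆S l∉C within-C = bounded _ _ _ within-C
          (λ i j i∈C j∈C → ind i j (C⊆S i∈C) (C⊆S j∈C)) (smaller C⊆S l∉C)

        weighA : totalWeight I A ≤ᶠ V k (suc l)
        weighA = part (proj₁ ∘ ∈-subset⁻ inA?) l∉A
          (λ i∈A → proj₁ (within (proj₁ (∈-subset⁻ inA? i∈A))) , proj₂ (∈-subset⁻ inA? i∈A))
        weighB : totalWeight I B ≤ᶠ V (suc l) m
        weighB = part (proj₁ ∘ ∈-subset⁻ inB?) l∉B
          (λ i∈B → proj₂ (∈-subset⁻ inB? i∈B) , proj₂ (within (proj₁ (∈-subset⁻ inB? i∈B))))

-- The algorithm

-- Integer array 1 holds the chosen sets: bit i of the set of boundaries (k , m)
-- is in cell k (n + 1)² + m (n + 1) + i, so that the set of (0 , 0), the pair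
-- imposing no constraint, is the output.  Integer arrays 2 and 3 hold the
-- multiples of n + 1 and of (n + 1)², scalar array 5 the anchors, scalar array 6
-- in cell k (n + 1)² + m (n + 1) the weight of the chosen set.  Integer arrays 4
-- to 8 and scalar array 7 hold one variable each.

x₁ᵉ y₁ᵉ x₂ᵉ y₂ᵉ weightᵉ anchorᵉ : IntExpr → ScalarExpr
x₁ᵉ     = scalarAt 0
y₁ᵉ     = scalarAt 1
x₂ᵉ     = scalarAt 2
y₂ᵉ     = scalarAt 3
weightᵉ = scalarAt 4
anchorᵉ = scalarAt 5

-- During the anchor search variable 4 is the rectangle `i`, variable 5 the rectangle whose right
-- end is tried, variable 6 the one compared with `i`; variable 8 becomes 1 when a comparison fails.
clearᶜ : Cond
clearᶜ = test (y₁ᵉ (var 6) ≤ˢ y₁ᵉ (var 4)) or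
         test (x₂ᵉ (var 5) ≤ˢ x₁ᵉ (var 6)) or test (x₂ᵉ (var 6) ≤ˢ x₂ᵉ (var 5))

acceptᶜ : Cond
acceptᶜ = test (var 8 ≤ⁱ const 0) and
  test (x₁ᵉ (var 4) ≤ˢ x₂ᵉ (var 5)) and test (x₂ᵉ (var 5) ≤ˢ x₂ᵉ (var 4))

-- The left end is stored untested as the default: it survives only if no right end is an anchor,
-- and then it must be one itself.
checkClear tryAnchor findAnchors : Cmd
checkClear = 8 [ const 0 ]≔ const 0 ⨾
  for 6 0 (if clearᶜ then nop else (8 [ const 0 ]≔ const 1))
tryAnchor = checkClear ⨾
  (if acceptᶜ then 5 [ var 4 ]≔ˢ x₂ᵉ (var 5) else nop)
findAnchors = for 4 0 (5 [ var 4 ]≔ˢ x₁ᵉ (var 4) ⨾ for 5 0 tryAnchor)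

-- Repeated addition, starting from the zero in cell 0. With offset 1 the cells up to `n + 1` are
-- filled; cell `n + 1` of array 2 is then the increment for array 3.
multiples : ℕ → IntExpr → Cmd
multiples a e = for 4 1 (a [ var 4 ⊕ const 1 ]≔ (intAt a (var 4) ⊕ e))

slot : IntExpr → IntExpr → IntExpr
slot k m = intAt 3 k ⊕ intAt 2 m

-- In the rounds variables 5 and 6 hold the boundaries `k` and `m`, variable 7 a rectangle. A
-- nonzero boundary `k` stands for rectangle `k - 1`, hence the subtractions.
leftᶜ rightᶜ : Cond
leftᶜ = test (var 5 ≤ⁱ const 0) or
  (test (x₂ᵉ (var 5 ⊖ const 1) ≤ˢ x₁ᵉ (var 7)) and test (y₂ᵉ (var 5 ⊖ const 1) ≤ˢ y₂ᵉ (var 7))) or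
  (test (anchorᵉ (var 5 ⊖ const 1) ≤ˢ x₁ᵉ (var 7)) and test (y₁ᵉ (var 5 ⊖ const 1) ≤ˢ y₂ᵉ (var 7)))
rightᶜ = test (var 6 ≤ⁱ const 0) or
  (test (x₂ᵉ (var 7) ≤ˢ x₁ᵉ (var 6 ⊖ const 1)) and test (y₂ᵉ (var 6 ⊖ const 1) ≤ˢ y₂ᵉ (var 7))) or
  (test (x₂ᵉ (var 7) ≤ˢ anchorᵉ (var 6 ⊖ const 1)) and test (y₁ᵉ (var 6 ⊖ const 1) ≤ˢ y₂ᵉ (var 7)))

candidateᵉ : ScalarExpr
candidateᵉ = scalarAt 6 (slot (var 5) (var 7 ⊕ const 1)) ⊞ weightᵉ (var 7) ⊞
             scalarAt 6 (slot (var 7 ⊕ const 1) (var 6))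

-- Variable 8 is the boundary number of the best splitting rectangle, or 0 if none beats the stored
-- value. Adding marks forms unions, as a sum of naturals is nonzero exactly if a summand is.
consider search copySets save improve solve : Cmd
consider = if leftᶜ and rightᶜ and neg (test (candidateᵉ ≤ˢ scalarAt 7 (const 0)))
  then (8 [ const 0 ]≔ (var 7 ⊕ const 1) ⨾ 7 [ const 0 ]≔ˢ candidateᵉ)
  else nop
search = 8 [ const 0 ]≔ const 0 ⨾ 7 [ const 0 ]≔ˢ scalarAt 6 (slot (var 5) (var 6)) ⨾ for 7 0 consider
copySets = for 7 0
  (1 [ slot (var 5) (var 6) ⊕ var 7 ]≔
    (intAt 1 (slot (var 5) (var 8) ⊕ var 7) ⊕ intAt 1 (slot (var 8) (var 6) ⊕ var 7)))
save = if test (var 8 ≤ⁱ const 0) then nop else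
  (6 [ slot (var 5) (var 6) ]≔ˢ scalarAt 7 (const 0) ⨾ copySets ⨾
   1 [ slot (var 5) (var 6) ⊕ (var 8 ⊖ const 1) ]≔ const 1)
improve = search ⨾ save
solve = findAnchors ⨾ multiples 2 (var 0 ⊕ const 1) ⨾ multiples 3 (intAt 2 (var 0 ⊕ const 1)) ⨾
  for 4 0 (for 5 1 (for 6 1 improve))

below-suc : ∀ {ℓ n} {P : Fin n → Set ℓ} {i : Fin n} → (∀ j → toℕ j < toℕ i → P j) → P i →
  ∀ j → toℕ j < suc (toℕ i) → P j
below-suc {P = P} below here j j≤i with m<1+n⇒m<n∨m≡n j≤i
... | inj₁ j<i = below j j<i
... | inj₂ j≡i = subst P (sym (toℕ-injective j≡i)) here

-- Correctness of the anchor search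

module Correctness {ℓ₀ ℓ₁ ℓ₂} (F : OrderedField ℓ₀ ℓ₁ ℓ₂) {n : ℕ} (I : MWISR.Instance F n) where
  open Order F
  open Machine F
  open Logic F
  open Size n

  -- Indexed by array contents instead of by a state, so that writing to other arrays leaves the
  -- type unchanged by computation.
  record Columns (size : ℕ) (X₁ Y₁ X₂ Y₂ W : ℕ → Carrier) : Set ℓ₀ where
    field
      at-size   : size ≡ n
      at-x₁     : ∀ {j i} → j ≡ toℕ i → X₁ j ≡ x₁ (I i)
      at-y₁     : ∀ {j i} → j ≡ toℕ i → Y₁ j ≡ y₁ (I i)
      at-x₂     : ∀ {j i} → j ≡ toℕ i → X₂ j ≡ x₂ (I i)
      at-y₂     : ∀ {j i} → j ≡ toℕ i → Y₂ j ≡ y₂ (I i)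
      at-weight : ∀ {j i} → j ≡ toℕ i → W j ≡ weight (I i)
  open Columns

  Inputs : State → Set ℓ₀
  Inputs s = Columns (ints s 0 0) (scalars s 0) (scalars s 1) (scalars s 2) (scalars s 3) (scalars s 4)

  inputs-frame : ∀ {c s s′} → writesInt c 0 ≡ false → writesScalar c 0 ≡ false →
    writesScalar c 1 ≡ false → writesScalar c 2 ≡ false → writesScalar c 3 ≡ false →
    writesScalar c 4 ≡ false → Frame c s s′ → Inputs s → Inputs s′
  inputs-frame i0 s0 s1 s2 s3 s4 f inp = record
    { at-size   = trans (same-int f 0 i0 0) (at-size inp)
    ; at-x₁     = λ j≡ → trans (same-scalar f 0 s0 _) (at-x₁ inp j≡)
    ; at-y₁     = λ j≡ → trans (same-scalar f 1 s1 _) (at-y₁ inp j≡)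
    ; at-x₂     = λ j≡ → trans (same-scalar f 2 s2 _) (at-x₂ inp j≡)
    ; at-y₂     = λ j≡ → trans (same-scalar f 3 s3 _) (at-y₂ inp j≡)
    ; at-weight = λ j≡ → trans (same-scalar f 4 s4 _) (at-weight inp j≡) }

  column-at : ∀ f {j i} → j ≡ toℕ i → column I f j ≡ f (I i)
  column-at f {i = i} refl with toℕ i <? n
  ... | yes i<n = cong (f ∘ I) (fromℕ<-toℕ i i<n)
  ... | no i≮n  = contradiction (toℕ<n i) i≮n

  input-inputs : Inputs (input I)
  input-inputs = record
    { at-size = refl ; at-x₁ = column-at x₁ ; at-y₁ = column-at y₁ ; at-x₂ = column-at x₂
    ; at-y₂ = column-at y₂ ; at-weight = column-at weight }

  coerce : ∀ {ℓ} {A B : Set ℓ} → A ≡ B → A → B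
  coerce = subst id

  -- An equality of propositions, because the scalars read equal the fields of the rectangles; it
  -- transports in both directions.
  clear-means : ∀ s {i c j} → Inputs s → ints s 4 0 ≡ toℕ i → ints s 5 0 ≡ toℕ c → ints s 6 0 ≡ toℕ j →
    Holds clearᶜ s ≡ Clear I i (x₂ (I c)) j
  clear-means s inp i≡ c≡ j≡ =
    cong₂ _⊎_ (cong₂ _≤ᶠ_ (at-y₁ inp j≡) (at-y₁ inp i≡))
    (cong₂ _⊎_ (cong₂ _≤ᶠ_ (at-x₂ inp c≡) (at-x₁ inp j≡))
               (cong₂ _≤ᶠ_ (at-x₂ inp j≡) (at-x₂ inp c≡)))

  Checked : Fin n → Fin n → ℕ → State → Set ℓ₂
  Checked i c t s =
    (ints s 8 0 ≡ 0 × (∀ j → toℕ j < t → Clear I i (x₂ (I c)) j)) ⊎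
    (ints s 8 0 ≡ 1 × (∃[ j ] ¬ Clear I i (x₂ (I c)) j))

  checkClear-ends : ∀ {s i c} → Inputs s → ints s 4 0 ≡ toℕ i → ints s 5 0 ≡ toℕ c →
    Ends checkClear s (Checked i c n)
  checkClear-ends {s} {i} {c} inp i≡ c≡ = int-ends {Q = Start} (inp , i≡ , c≡ , refl) andThen
    λ { {s₁} _ (inp , i≡ , c≡ , ok) → for-ends (Checked i c) (at-size inp) refl refl refl id
      (inj₁ (ok , λ _ ()))
      λ j {s} f j≡ checked → step s (inputs-frame refl refl refl refl refl refl f inp)
        (trans (same-int f 4 refl 0) i≡) (trans (same-int f 5 refl 0) c≡) j j≡ checked }
    where
    Start : State → Set ℓ₀
    Start s = Inputs s × ints s 4 0 ≡ toℕ i × ints s 5 0 ≡ toℕ c × ints s 8 0 ≡ 0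

    step : ∀ s → Inputs s → ints s 4 0 ≡ toℕ i → ints s 5 0 ≡ toℕ c → ∀ j → ints s 6 0 ≡ toℕ j →
      Checked i c (toℕ j) s → Ends (if clearᶜ then nop else (8 [ const 0 ]≔ const 1)) s (Checked i c (suc (toℕ j)))
    step s inp i≡ c≡ j j≡ checked = if-ends
      (λ h → nop-ends ([ (λ (ok , clear) → inj₁ (ok , below-suc clear (coerce meaning h))) , inj₂ ]′ checked))
      (λ ¬h → int-ends (inj₂ (refl , j , λ clear → ¬h (coerce (sym meaning) clear))))
      where meaning = clear-means s inp i≡ c≡ j≡

  module _ (visible : EachVisibleFromAbove I) where

    AnchorsBelow : ℕ → State → Set ℓ₂
    AnchorsBelow t s = ∀ i → toℕ i < t → IsAnchor I i (scalars s 5 (toℕ i))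

    -- While the default is in place, refutations of all right ends tried so far are collected.
    Tried : Fin n → ℕ → State → Set (ℓ₀ ⊔ℓ ℓ₂)
    Tried i t s = Inputs s × AnchorsBelow (toℕ i) s × ints s 4 0 ≡ toℕ i ×
      ((scalars s 5 (toℕ i) ≡ x₁ (I i) × (∀ c → toℕ c < t → ¬ IsAnchor I i (x₂ (I c)))) ⊎
       IsAnchor I i (scalars s 5 (toℕ i)))

    anchors-other : ∀ s {i : Fin n} {j v} → AnchorsBelow (toℕ i) s → j ≡ toℕ i →
      AnchorsBelow (toℕ i) ⟨ ints s , write (scalars s) 5 j v ⟩
    anchors-other s below j≡ i′ i′< =
      subst (IsAnchor I i′) (sym (write-other (scalars s) 5 (λ j≡′ → <⇒≢ i′< (trans (sym j≡′) j≡))))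
        (below i′ i′<)

    tryAnchor-ends : ∀ {s i} c → ints s 5 0 ≡ toℕ c → Tried i (toℕ c) s →
      Ends tryAnchor s (Tried i (suc (toℕ c)))
    tryAnchor-ends {s} {i} c c≡ (inp , below , i≡ , current) = checkClear-ends inp i≡ c≡ andThen
      λ {s₁} f checked → decide s₁ (inputs-frame refl refl refl refl refl refl f inp)
        (λ i′ i′< → subst (IsAnchor I i′) (sym (same-scalar f 5 refl _)) (below i′ i′<))
        (trans (same-int f 4 refl 0) i≡) (trans (same-int f 5 refl 0) c≡)
        ([ (λ (x≡ , none) → inj₁ (trans (same-scalar f 5 refl _) x≡ , none))
         , (λ anc → inj₂ (subst (IsAnchor I i) (sym (same-scalar f 5 refl _)) anc)) ]′ current)
        checked
      where
      decide : ∀ s → Inputs s → AnchorsBelow (toℕ i) s → ints s 4 0 ≡ toℕ i → ints s 5 0 ≡ toℕ c →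
        ((scalars s 5 (toℕ i) ≡ x₁ (I i) × (∀ c′ → toℕ c′ < toℕ c → ¬ IsAnchor I i (x₂ (I c′)))) ⊎
          IsAnchor I i (scalars s 5 (toℕ i))) →
        Checked i c n s → Ends (if acceptᶜ then 5 [ var 4 ]≔ˢ x₂ᵉ (var 5) else nop) s (Tried i (suc (toℕ c)))
      decide s inp below i≡ c≡ current checked = if-ends
        (λ (lift ok , left , right) → scalar-ends
          ( inp
          , anchors-other s below i≡ , i≡
          , inj₂ (subst (IsAnchor I i) (sym (trans (write-same (scalars s) 5 i≡) (at-x₂ inp c≡)))
              (clear ok , coerce left≡ left , coerce right≡ right))))
        (λ no-anchor → nop-ends (inp , below , i≡ ,
          [ (λ (x≡ , none) → inj₁ (x≡ , below-suc {P = λ c → ¬ IsAnchor I i (x₂ (I c))} none (refuted no-anchor))) , inj₂ ]′ current))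
        where
        left≡ = cong₂ _≤ᶠ_ (at-x₁ inp i≡) (at-x₂ inp c≡)
        right≡ = cong₂ _≤ᶠ_ (at-x₂ inp c≡) (at-x₂ inp i≡)

        clear : ints s 8 0 ≤ 0 → ∀ j → Clear I i (x₂ (I c)) j
        clear ok j = [ (λ (_ , all) → all j (toℕ<n j))
                     , (λ (bad , _) → contradiction (trans (sym bad) (n≤0⇒n≡0 ok)) λ ()) ]′ checked

        refuted : ¬ Holds acceptᶜ s → ¬ IsAnchor I i (x₂ (I c))
        refuted no-anchor (all , left , right) =
          [ (λ (ok , _) → no-anchor (lift (≤-reflexive ok) , coerce (sym left≡) left , coerce (sym right≡) right))
          , (λ (_ , j , not-clear) → not-clear (all j)) ]′ checked

    findAnchors-ends : ∀ {s} → Inputs s →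
      Ends findAnchors s (λ s′ → ∀ i → IsAnchor I i (scalars s′ 5 (toℕ i)))
    findAnchors-ends inp = for-ends AnchorsBelow (at-size inp) refl refl refl id (λ _ ())
      (λ i {s} f i≡ below → step s i i≡ (inputs-frame refl refl refl refl refl refl f inp) below)
      implies λ {s} _ below i → below i (toℕ<n i)
      where
      finish : ∀ s i → Tried i n s → AnchorsBelow (suc (toℕ i)) s
      finish s i (_ , below , _ , inj₂ anchor) = below-suc {P = λ i → IsAnchor I i (scalars s 5 (toℕ i))} below anchor
      -- The default survived, so every right end is refuted and `anchor-exists` leaves only the
      -- left end.
      finish s i (_ , below , _ , inj₁ (x≡ , none)) with anchor-exists I visible i
      ... | inj₁ anchor       = below-suc below (subst (IsAnchor I i) (sym x≡) anchor)
      ... | inj₂ (c , anchor) = contradiction anchor (none c (toℕ<n c))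

      step : ∀ s i → ints s 4 0 ≡ toℕ i → Inputs s → AnchorsBelow (toℕ i) s →
        Ends (5 [ var 4 ]≔ˢ x₁ᵉ (var 4) ⨾ for 5 0 tryAnchor) s (AnchorsBelow (suc (toℕ i)))
      step s i i≡ inp below = scalar-ends {Q = Tried i 0}
        ( inp
        , anchors-other s below i≡ , i≡
        , inj₁ (trans (write-same (scalars s) 5 i≡) (at-x₁ inp i≡) , λ _ ()))
        andThen λ _ tried → for-ends (Tried i) (at-size (proj₁ tried)) refl refl refl
          (λ (inp , rest) → inp , rest) tried
          (λ c _ c≡ → tryAnchor-ends c c≡)
          implies λ {s} _ → finish s i

-- Correctness of the dynamic program

module Solver {ℓ₀ ℓ₁ ℓ₂} (F : OrderedField ℓ₀ ℓ₁ ℓ₂) {n : ℕ} (I : MWISR.Instance F n) where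
  open Order F
  open Machine F
  open Logic F
  open Size n
  open Correctness F I
  open Columns

  -- The increment has to keep its value throughout the loop, so `e≡` ranges over all states within
  -- the loop's frame.
  multiples-ends : ∀ a e d {s} → (a ≡ᵇ 0) ≡ false → (a ≡ᵇ 4) ≡ false → (4 ≡ᵇ a) ≡ false →
    ints s 0 0 ≡ n → ints s a 0 ≡ 0 → (∀ {s′} → Frame (multiples a e) s s′ → evalInt e s′ ≡ d) →
    Ends (multiples a e) s (λ s′ → ∀ j → j ≤ suc n → ints s′ a j ≡ j * d)
  multiples-ends a e d {s} a≠0 a≠4 4≠a size start e≡ =
    for-ends (λ i s′ → ∀ j → j ≤ i → ints s′ a j ≡ j * d) size refl a≠0 a≠4
      (λ {_} {x} {s′} known j j≤ → trans (write-array (ints s′) 4 0 x j 4≠a) (known j j≤))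
      (λ { zero _ → start })
      λ i {s′} f i≡ known → int-ends (λ j j≤ → step i {s′} f i≡ known j (m≤n⇒m<n∨m≡n j≤))
    where
    step : ∀ (i : Fin (suc n)) {s′} → Frame (multiples a e) s s′ → ints s′ 4 0 ≡ toℕ i →
      (∀ j → j ≤ toℕ i → ints s′ a j ≡ j * d) → ∀ j → j < suc (toℕ i) ⊎ j ≡ suc (toℕ i) →
      write (ints s′) a (ints s′ 4 0 + 1) (ints s′ a (ints s′ 4 0) + evalInt e s′) a j ≡ j * d
    step i {s′} f i≡ known j (inj₁ j<) =
      trans (write-other (ints s′) a (λ eq → <⇒≢ j< (trans (sym eq) (trans (+-comm _ 1) (cong suc i≡)))))
            (known j (≤-pred j<))
    step i {s′} f i≡ known j (inj₂ refl) = trans (write-same (ints s′) a (trans (+-comm _ 1) (cong suc i≡)))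
      (trans (cong₂ _+_ (trans (cong (ints s′ a) i≡) (known (toℕ i) ≤-refl)) (e≡ f)) (+-comm _ d))

  module Table (a : Fin n → Carrier) (anchored : ∀ i → IsAnchor I i (a i)) where
    open Splitting I a anchored

    Boundary : Set
    Boundary = Fin (suc n)

    base : Boundary → Boundary → ℕ
    base k m = toℕ k * (suc n * suc n) + toℕ m * suc n

    -- A cell number is a numeral with digits `k`, `m`, `i` in base `n + 1`, that is, a nested
    -- `combine`.
    base-injective : ∀ {k m k′ m′ : Boundary} {i j} → i < suc n → j < suc n →
      base k m + i ≡ base k′ m′ + j → (k ≡ k′ × m ≡ m′) × i ≡ j
    base-injective {k} {m} {k′} {m′} i< j< eq
      with combine-injective k (combine m (fromℕ< i<)) k′ (combine m′ (fromℕ< j<))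
             (toℕ-injective (trans (position k m i<) (trans eq (sym (position k′ m′ j<)))))
      where
      position : ∀ k m {i} (i< : i < suc n) → toℕ (combine k (combine m (fromℕ< i<))) ≡ base k m + i
      position k m {i} i< = begin
        toℕ (combine k (combine m (fromℕ< i<)))                 ≡⟨ toℕ-combine k (combine m (fromℕ< i<)) ⟩
        suc n * suc n * toℕ k + toℕ (combine m (fromℕ< i<))     ≡⟨ cong₂ _+_ (*-comm (suc n * suc n) (toℕ k)) (toℕ-combine m (fromℕ< i<)) ⟩
        toℕ k * (suc n * suc n) + (suc n * toℕ m + toℕ (fromℕ< i<))
          ≡⟨ cong₂ (λ x y → toℕ k * (suc n * suc n) + (x + y)) (*-comm (suc n) (toℕ m)) (toℕ-fromℕ< i<) ⟩
        toℕ k * (suc n * suc n) + (toℕ m * suc n + i)           ≡⟨ +-assoc (toℕ k * (suc n * suc n)) _ _ ⟨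
        base k m + i                                            ∎
        where open ≡-Reasoning
    ... | k≡ , rest with combine-injective m (fromℕ< i<) m′ (fromℕ< j<) rest
    ... | m≡ , i≡ = (k≡ , m≡) , trans (sym (toℕ-fromℕ< i<)) (trans (cong toℕ i≡) (toℕ-fromℕ< j<))

    cell-injective : ∀ {k m k′ m′ : Boundary} {i j : Fin n} →
      base k m + toℕ i ≡ base k′ m′ + toℕ j → (k ≡ k′ × m ≡ m′) × i ≡ j
    cell-injective {i = i} {j} eq with base-injective (m<n⇒m<1+n (toℕ<n i)) (m<n⇒m<1+n (toℕ<n j)) eq
    ... | boundaries , i≡j = boundaries , toℕ-injective i≡j

    record Static (size : ℕ) (X₁ Y₁ X₂ Y₂ W A : ℕ → Carrier) (rows blocks : ℕ → ℕ) : Set ℓ₀ where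
      field
        columns   : Columns size X₁ Y₁ X₂ Y₂ W
        at-anchor : ∀ {j i} → j ≡ toℕ i → A j ≡ a i
        at-row    : ∀ (m : Boundary) → rows (toℕ m) ≡ toℕ m * suc n
        at-block  : ∀ (k : Boundary) → blocks (toℕ k) ≡ toℕ k * (suc n * suc n)
    open Static

    Env : State → Set ℓ₀
    Env s = Static (ints s 0 0) (scalars s 0) (scalars s 1) (scalars s 2) (scalars s 3) (scalars s 4)
              (scalars s 5) (ints s 2) (ints s 3)

    env-frame : ∀ {c s s′} → writesInt c 0 ≡ false → writesInt c 2 ≡ false → writesInt c 3 ≡ false →
      writesScalar c 0 ≡ false → writesScalar c 1 ≡ false → writesScalar c 2 ≡ false →
      writesScalar c 3 ≡ false → writesScalar c 4 ≡ false → writesScalar c 5 ≡ false →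
      Frame c s s′ → Env s → Env s′
    env-frame i0 i2 i3 s0 s1 s2 s3 s4 s5 f env = record
      { columns   = inputs-frame i0 s0 s1 s2 s3 s4 f (columns env)
      ; at-anchor = λ j≡ → trans (same-scalar f 5 s5 _) (at-anchor env j≡)
      ; at-row    = λ m → trans (same-int f 2 i2 _) (at-row env m)
      ; at-block  = λ k → trans (same-int f 3 i3 _) (at-block env k) }

    slot-at : ∀ {s} → Env s → ∀ e f {k m : Boundary} → evalInt e s ≡ toℕ k → evalInt f s ≡ toℕ m →
      evalInt (slot e f) s ≡ base k m
    slot-at {s} env e f {k} {m} e≡ f≡ =
      cong₂ _+_ (trans (cong (ints s 3) e≡) (at-block env k)) (trans (cong (ints s 2) f≡) (at-row env m))

    value : State → Boundary → Boundary → Carrier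
    value s k m = scalars s 6 (base k m)

    mark : State → Boundary → Boundary → Fin n → ℕ
    mark s k m i = ints s 1 (base k m + toℕ i)

    marked? : ∀ s k m i → Dec (mark s k m i ≢ 0)
    marked? s k m i = ¬? (mark s k m i ≟ 0)

    chosen : State → Boundary → Boundary → Subset n
    chosen s k m = subset (marked? s k m)

    candidate : (Boundary → Boundary → Carrier) → Boundary → Boundary → Fin n → Carrier
    candidate V k m l = V k (suc l) +ᶠ weight (I l) +ᶠ V (suc l) m

    candidate-at : ∀ {s k m l} → Env s → ints s 5 0 ≡ toℕ k → ints s 6 0 ≡ toℕ m → ints s 7 0 ≡ toℕ l →
      evalScalar candidateᵉ s ≡ candidate (value s) k m l
    candidate-at {s} {k} {m} {l} env k≡ m≡ l≡ =
      cong₂ _+ᶠ_ (cong₂ _+ᶠ_ (cong (scalars s 6) (slot-at {s} env (var 5) (var 7 ⊕ const 1) {k} {suc l} k≡ 1+l≡))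
                             (at-weight (columns env) l≡))
                 (cong (scalars s 6) (slot-at {s} env (var 7 ⊕ const 1) (var 6) {suc l} {m} 1+l≡ m≡))
      where
      1+l≡ : ints s 7 0 + 1 ≡ suc (toℕ l)
      1+l≡ = trans (+-comm _ 1) (cong suc l≡)

    -- Two implications, since at `zero` one side is the unit type and the other a disjunction of
    -- tests. At `suc k` the first test fails and the truncated subtraction is exact.
    left-means : ∀ s k {l} → Env s → ints s 5 0 ≡ toℕ k → ints s 7 0 ≡ toℕ l →
      (Holds leftᶜ s → Left k l) × (Left k l → Holds leftᶜ s)
    left-means s zero env k≡ l≡ = (λ _ → tt) , (λ _ → inj₁ (lift (≤-reflexive k≡)))
    left-means s (suc k) {l} env k≡ l≡ =
      [ (λ (lift k≤0) → contradiction (trans (sym k≡) (n≤0⇒n≡0 k≤0)) λ ()) , coerce meaning ]′ ,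
      inj₂ ∘ coerce (sym meaning)
      where
      inp = columns env
      k-1≡ : ints s 5 0 ∸ 1 ≡ toℕ k
      k-1≡ = cong (_∸ 1) k≡
      meaning = cong₂ _⊎_
        (cong₂ _×_ (cong₂ _≤ᶠ_ (at-x₂ inp k-1≡) (at-x₁ inp l≡)) (cong₂ _≤ᶠ_ (at-y₂ inp k-1≡) (at-y₂ inp l≡)))
        (cong₂ _×_ (cong₂ _≤ᶠ_ (at-anchor env k-1≡) (at-x₁ inp l≡)) (cong₂ _≤ᶠ_ (at-y₁ inp k-1≡) (at-y₂ inp l≡)))

    right-means : ∀ s m {l} → Env s → ints s 6 0 ≡ toℕ m → ints s 7 0 ≡ toℕ l →
      (Holds rightᶜ s → Right m l) × (Right m l → Holds rightᶜ s)
    right-means s zero env m≡ l≡ = (λ _ → tt) , (λ _ → inj₁ (lift (≤-reflexive m≡)))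
    right-means s (suc m) {l} env m≡ l≡ =
      [ (λ (lift m≤0) → contradiction (trans (sym m≡) (n≤0⇒n≡0 m≤0)) λ ()) , coerce meaning ]′ ,
      inj₂ ∘ coerce (sym meaning)
      where
      inp = columns env
      m-1≡ : ints s 6 0 ∸ 1 ≡ toℕ m
      m-1≡ = cong (_∸ 1) m≡
      meaning = cong₂ _⊎_
        (cong₂ _×_ (cong₂ _≤ᶠ_ (at-x₂ inp l≡) (at-x₁ inp m-1≡)) (cong₂ _≤ᶠ_ (at-y₂ inp m-1≡) (at-y₂ inp l≡)))
        (cong₂ _×_ (cong₂ _≤ᶠ_ (at-x₂ inp l≡) (at-anchor env m-1≡)) (cong₂ _≤ᶠ_ (at-y₁ inp m-1≡) (at-y₂ inp l≡)))

    -- Search for the best splitting rectangle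

    record BestBelow (V : Boundary → Boundary → Carrier) (k m : Boundary) (t : ℕ) (b : ℕ) (β : Carrier) :
        Set (ℓ₀ ⊔ℓ ℓ₂) where
      field
        origin : (b ≡ 0 × β ≡ V k m) ⊎
                 (∃[ l ] b ≡ suc (toℕ l) × Left k l × Right m l × β ≡ candidate V k m l)
        above  : V k m ≤ᶠ β
        beats  : ∀ l → toℕ l < t → Left k l → Right m l → candidate V k m l ≤ᶠ β
    open BestBelow

    Located : Boundary → Boundary → State → Set ℓ₀
    Located k m s = Env s × ints s 5 0 ≡ toℕ k × ints s 6 0 ≡ toℕ m

    search-ends : ∀ {s k m} → Located k m s →
      Ends search s (λ s′ → BestBelow (value s) k m n (ints s′ 8 0) (scalars s′ 7 0))
    search-ends {s} {k} {m} (env , k≡ , m≡) =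
      int-ends {Q = λ s′ → Located k m s′ × ints s′ 8 0 ≡ 0 × scalars s′ 6 ≡ scalars s 6}
        ((env , k≡ , m≡) , refl , refl) andThen
      λ { {s₁} _ ((env , k≡ , m≡) , none , table) →
      scalar-ends {Q = λ s′ → Located k m s′ × BestBelow (value s) k m 0 (ints s′ 8 0) (scalars s′ 7 0) ×
                              scalars s′ 6 ≡ scalars s 6}
        ((env , k≡ , m≡)
        , start none (trans (cong (scalars s₁ 6) (slot-at {s₁} env (var 5) (var 6) {k} {m} k≡ m≡)) (cong (λ f → f (base k m)) table))
        , table) andThen
      λ { {s₂} _ ((env , k≡ , m≡) , best , table) →
      for-ends (λ t s′ → Located k m s′ × BestBelow (value s) k m t (ints s′ 8 0) (scalars s′ 7 0))
        (at-size (columns env)) refl refl refl id ((env , k≡ , m≡) , best)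
        (λ l {s₃} f l≡ (located , best) → step l s₃ located l≡
           (λ j → trans (same-scalar f 6 refl j) (cong (λ g → g j) table)) best)
      implies λ _ → proj₂ } }
      where
      start : ∀ {b β} → b ≡ 0 → β ≡ value s k m → BestBelow (value s) k m 0 b β
      start b≡0 β≡ = record
        { origin = inj₁ (b≡0 , β≡) ; above = ≤ᶠ-reflexive (Eq.reflexive (sym β≡)) ; beats = λ _ () }

      step : ∀ l s₃ → Located k m s₃ → ints s₃ 7 0 ≡ toℕ l → (∀ j → scalars s₃ 6 j ≡ scalars s 6 j) →
        BestBelow (value s) k m (toℕ l) (ints s₃ 8 0) (scalars s₃ 7 0) →
        Ends consider s₃ (λ s′ → Located k m s′ × BestBelow (value s) k m (suc (toℕ l)) (ints s′ 8 0) (scalars s′ 7 0))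
      step l s₃ (env , k≡ , m≡) l≡ table best = if-ends
        (λ (left , right , better) →
          int-ends {Q = λ s′ → Located k m s′ × ints s′ 7 0 ≡ toℕ l × ints s′ 8 0 ≡ suc (toℕ l) ×
                               (∀ j → scalars s′ 6 j ≡ scalars s 6 j)}
            ((env , k≡ , m≡) , l≡ , trans (+-comm _ 1) (cong suc l≡) , table) andThen
          λ { {s₄} _ ((env , k≡ , m≡) , l≡ , b≡ , table) →
          scalar-ends ((env , k≡ , m≡) ,
            improved (proj₁ left-meaning left) (proj₁ right-meaning right)
              b≡ (candidate≡ s₄ env k≡ m≡ l≡ table) (≰⇒≥ᶠ (better ∘ subst (_≤ᶠ _) (sym candidate≡₃))) ) })
        (λ no-better → nop-ends ((env , k≡ , m≡) , record
          { origin = origin best ; above = above best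
          ; beats = below-suc {P = λ l → Left k l → Right m l → candidate (value s) k m l ≤ᶠ scalars s₃ 7 0}
              (beats best) (λ left right → kept no-better left right) }))
        where
        left-meaning = left-means s₃ k env k≡ l≡
        right-meaning = right-means s₃ m env m≡ l≡

        candidate≡ : ∀ s′ → Env s′ → ints s′ 5 0 ≡ toℕ k → ints s′ 6 0 ≡ toℕ m → ints s′ 7 0 ≡ toℕ l →
          (∀ j → scalars s′ 6 j ≡ scalars s 6 j) → evalScalar candidateᵉ s′ ≡ candidate (value s) k m l
        candidate≡ s′ env k≡ m≡ l≡ table = trans (candidate-at {s′} env k≡ m≡ l≡)
          (cong₂ (λ u v → u +ᶠ weight (I l) +ᶠ v) (table _) (table _))

        candidate≡₃ : evalScalar candidateᵉ s₃ ≡ candidate (value s) k m l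
        candidate≡₃ = candidate≡ s₃ env k≡ m≡ l≡ table

        kept : ¬ Holds (leftᶜ and rightᶜ and neg (test (candidateᵉ ≤ˢ scalarAt 7 (const 0)))) s₃ →
          Left k l → Right m l → candidate (value s) k m l ≤ᶠ scalars s₃ 7 0
        kept no-better left right with candidate (value s) k m l ≤ᶠ? scalars s₃ 7 0
        ... | yes ≤β = ≤β
        ... | no ≰β  = contradiction
          (proj₂ left-meaning left , proj₂ right-meaning right ,
           ≰β ∘ subst (_≤ᶠ _) candidate≡₃) no-better

        improved : ∀ {b β} → Left k l → Right m l → b ≡ suc (toℕ l) → β ≡ candidate (value s) k m l →
          scalars s₃ 7 0 ≤ᶠ candidate (value s) k m l → BestBelow (value s) k m (suc (toℕ l)) b β
        improved left right b≡ refl old≤ = record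
          { origin = inj₂ (l , b≡ , left , right , refl)
          ; above  = ≤ᶠ-trans (above best) old≤
          ; beats  = below-suc {P = λ l′ → Left k l′ → Right m l′ → candidate (value s) k m l′ ≤ᶠ candidate (value s) k m l}
              (λ l′ l′< left′ right′ → ≤ᶠ-trans (beats best l′ l′< left′ right′) old≤) (λ _ _ → ≤ᶠ-refl) }

    -- Storing a new value together with its set

    chosen-cong : ∀ {s s′ k m} → (∀ i → mark s′ k m i ≡ mark s k m i) → chosen s′ k m ≡ chosen s k m
    chosen-cong same = tabulate-cong (λ i → cong (λ x → does (¬? (x ≟ 0))) (same i))

    SameMarks : Boundary → Boundary → State → State → Set
    SameMarks k m s s′ = ∀ k′ m′ → ¬ (k′ ≡ k × m′ ≡ m) → ∀ i → mark s′ k′ m′ i ≡ mark s k′ m′ i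

    SameValues : Boundary → Boundary → State → State → Set ℓ₀
    SameValues k m s s′ = ∀ k′ m′ → ¬ (k′ ≡ k × m′ ≡ m) → value s′ k′ m′ ≡ value s k′ m′

    -- As `suc l` differs from `k` and `m`, both source sets are stored apart from the target, and
    -- copying in place reads the original marks.
    copySets-ends : ∀ {s k m l} → Located k m s → ints s 8 0 ≡ suc (toℕ l) → suc l ≢ k → suc l ≢ m →
      Ends copySets s (λ s′ → (∀ i → mark s′ k m i ≡ mark s k (suc l) i + mark s (suc l) m i) ×
                              SameMarks k m s s′)
    copySets-ends {s} {k} {m} {l} (env , k≡ , m≡) b≡ l≢k l≢m =
      for-ends Copied (at-size (columns env)) refl refl refl id ((λ _ ()) , λ _ _ _ _ → refl) step
      implies λ _ (sums , same) → (λ i → sums i (toℕ<n i)) , same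
      where
      Copied : ℕ → State → Set
      Copied t s′ = (∀ i → toℕ i < t → mark s′ k m i ≡ mark s k (suc l) i + mark s (suc l) m i) ×
                    SameMarks k m s s′

      step : ∀ i {s′} → Frame copySets s s′ → ints s′ 7 0 ≡ toℕ i → Copied (toℕ i) s′ →
        Ends _ s′ (Copied (suc (toℕ i)))
      step i {s′} f i≡ (sums , same) = int-ends
        ( below-suc {P = λ j → write (ints s′) 1 target new 1 (base k m + toℕ j) ≡
                               mark s k (suc l) j + mark s (suc l) m j}
            (λ j j<i → trans (write-other (ints s′) 1 (λ eq →
                <⇒≢ j<i (cong toℕ (sym (proj₂ (cell-injective {k} {m} {k} {m} (trans (sym target≡) eq)))))))
              (sums j j<i))
            (trans (write-same (ints s′) 1 target≡) new≡)
        , λ k′ m′ other j → trans (write-other (ints s′) 1 (λ eq →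
              other (map-× sym sym (proj₁ (cell-injective {k} {m} {k′} {m′} {i} {j} (trans (sym target≡) eq))))))
            (same k′ m′ other j))
        where
        env′ = env-frame {s = s} {s′} refl refl refl refl refl refl refl refl refl f env
        k≡′ = trans (same-int f 5 refl 0) k≡
        m≡′ = trans (same-int f 6 refl 0) m≡
        b≡′ : ints s′ 8 0 ≡ toℕ (suc l)
        b≡′ = trans (same-int f 8 refl 0) b≡
        target = evalInt (slot (var 5) (var 6) ⊕ var 7) s′
        new = evalInt (intAt 1 (slot (var 5) (var 8) ⊕ var 7) ⊕ intAt 1 (slot (var 8) (var 6) ⊕ var 7)) s′
        target≡ : target ≡ base k m + toℕ i
        target≡ = cong₂ _+_ (slot-at {s′} env′ (var 5) (var 6) {k} {m} k≡′ m≡′) i≡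
        new≡ : new ≡ mark s k (suc l) i + mark s (suc l) m i
        new≡ = cong₂ _+_
          (trans (cong (ints s′ 1) (cong₂ _+_ (slot-at {s′} env′ (var 5) (var 8) {k} {suc l} k≡′ b≡′) i≡))
                 (same k (suc l) (l≢m ∘ proj₂) i))
          (trans (cong (ints s′ 1) (cong₂ _+_ (slot-at {s′} env′ (var 8) (var 6) {suc l} {m} b≡′ m≡′) i≡))
                 (same (suc l) m (l≢k ∘ proj₁) i))

    record Stored (k m : Boundary) (l : Fin n) (s s′ : State) : Set ℓ₀ where
      field
        stored      : value s′ k m ≡ scalars s 7 0
        joined      : IsJoin l (chosen s k (suc l)) (chosen s (suc l) m) (chosen s′ k m)
        same-values : SameValues k m s s′
        same-marks  : SameMarks k m s s′
    open Stored

    -- Copying overwrites every bit of the target set, so the bit of `l` is set afterwards.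
    save-ends : ∀ {s k m l} → Located k m s → ints s 8 0 ≡ suc (toℕ l) → suc l ≢ k → suc l ≢ m →
      Ends save s (Stored k m l s)
    save-ends {s} {k} {m} {l} (env , k≡ , m≡) b≡ l≢k l≢m = if-ends
      (λ (lift b≤0) → contradiction (trans (sym b≡) (n≤0⇒n≡0 b≤0)) λ ())
      (λ _ → scalar-ends {Q = λ s′ → Located k m s′ × ints s′ 8 0 ≡ suc (toℕ l) ×
                (value s′ k m ≡ scalars s 7 0 × SameValues k m s s′) × ints s′ 1 ≡ ints s 1}
          ((env , k≡ , m≡) , b≡
          , (write-same (scalars s) 6 target≡
            , λ k′ m′ other → write-other (scalars s) 6 (λ eq → other (apart (trans (sym target≡) eq))))
          , refl) andThen
        λ { {s₁} _ (located , b≡ , values , marks) → copySets-ends {s₁} {k} {m} {l} located b≡ l≢k l≢m andThen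
        λ { {s₂} f (sums , same) → int-ends (finish s₂ f located b≡ values marks sums same) } })
      where
      target≡ = slot-at {s} env (var 5) (var 6) {k} {m} k≡ m≡

      apart : ∀ {k′ m′} → base k m ≡ base k′ m′ → k′ ≡ k × m′ ≡ m
      apart {k′} {m′} eq with base-injective {k} {m} {k′} {m′} (s≤s z≤n) (s≤s z≤n) (cong (_+ 0) eq)
      ... | (refl , refl) , _ = refl , refl

      finish : ∀ {s₁} s₂ → Frame copySets s₁ s₂ → Located k m s₁ → ints s₁ 8 0 ≡ suc (toℕ l) →
        (value s₁ k m ≡ scalars s 7 0 × SameValues k m s s₁) → ints s₁ 1 ≡ ints s 1 →
        (∀ i → mark s₂ k m i ≡ mark s₁ k (suc l) i + mark s₁ (suc l) m i) → SameMarks k m s₁ s₂ →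
        Stored k m l s (⟨ write (ints s₂) 1 (evalInt (slot (var 5) (var 6) ⊕ (var 8 ⊖ const 1)) s₂) 1 , scalars s₂ ⟩)
      finish {s₁} s₂ f (env , k≡ , m≡) b≡ (stored , values) marks sums same = record
        { stored = trans (same-scalar f 6 refl _) stored
        ; same-values = λ k′ m′ other → trans (same-scalar f 6 refl _) (values k′ m′ other)
        ; same-marks = λ k′ m′ other i → trans (write-other (ints s₂) 1 (λ eq →
              other (map-× sym sym (proj₁ (cell-injective {k} {m} {k′} {m′} {l} {i} (trans (sym cell≡) eq))))))
            (trans (same k′ m′ other i) (cong (λ g → g _) marks))
        ; joined = λ i → into i , from i }
        where
        env₂ = env-frame {s = s₁} {s₂} refl refl refl refl refl refl refl refl refl f env
        s₃ : State
        s₃ = ⟨ write (ints s₂) 1 (evalInt (slot (var 5) (var 6) ⊕ (var 8 ⊖ const 1)) s₂) 1 , scalars s₂ ⟩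

        cell≡ : evalInt (slot (var 5) (var 6) ⊕ (var 8 ⊖ const 1)) s₂ ≡ base k m + toℕ l
        cell≡ = cong₂ _+_
          (slot-at {s₂} env₂ (var 5) (var 6) {k} {m} (trans (same-int f 5 refl 0) k≡) (trans (same-int f 6 refl 0) m≡))
          (cong (_∸ 1) (trans (same-int f 8 refl 0) b≡))

        mark-l : mark s₃ k m l ≡ 1
        mark-l = write-same (ints s₂) 1 cell≡

        mark-other : ∀ i → i ≢ l → mark s₃ k m i ≡ mark s k (suc l) i + mark s (suc l) m i
        mark-other i i≢l = trans (write-other (ints s₂) 1 (λ eq →
            i≢l (sym (proj₂ (cell-injective {k} {m} {k} {m} {l} {i} (trans (sym cell≡) eq))))))
          (trans (sums i) (cong (λ g → g (base k (suc l) + toℕ i) + g (base (suc l) m + toℕ i)) marks))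

        into : ∀ i → i ∈ chosen s₃ k m → i ≡ l ⊎ i ∈ chosen s k (suc l) ⊎ i ∈ chosen s (suc l) m
        into i i∈ with i ≟ꟳ l | mark s k (suc l) i ≟ 0
        ... | yes i≡l | _ = inj₁ i≡l
        ... | no i≢l | no ≢0 = inj₂ (inj₁ (∈-subset⁺ (marked? s k (suc l)) ≢0))
        ... | no i≢l | yes ≡0 = inj₂ (inj₂ (∈-subset⁺ (marked? s (suc l) m) (λ ≡0′ →
                ∈-subset⁻ (marked? s₃ k m) i∈ (trans (mark-other i i≢l) (cong₂ _+_ ≡0 ≡0′)))))

        from : ∀ i → i ≡ l ⊎ i ∈ chosen s k (suc l) ⊎ i ∈ chosen s (suc l) m → i ∈ chosen s₃ k m
        from i i∈ with i ≟ꟳ l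
        ... | yes refl = ∈-subset⁺ (marked? s₃ k m) (λ ≡0 → contradiction (trans (sym mark-l) ≡0) λ ())
        from i (inj₁ i≡l)        | no i≢l = contradiction i≡l i≢l
        from i (inj₂ (inj₁ i∈A)) | no i≢l = ∈-subset⁺ (marked? s₃ k m) (λ ≡0 →
          ∈-subset⁻ (marked? s k (suc l)) i∈A (m+n≡0⇒m≡0 _ (trans (sym (mark-other i i≢l)) ≡0)))
        from i (inj₂ (inj₂ i∈B)) | no i≢l = ∈-subset⁺ (marked? s₃ k m) (λ ≡0 →
          ∈-subset⁻ (marked? s (suc l) m) i∈B (m+n≡0⇒n≡0 (mark s k (suc l) i) (trans (sym (mark-other i i≢l)) ≡0)))

    -- Invariants of the rounds

    Sound : State → Set (ℓ₁ ⊔ℓ ℓ₂)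
    Sound s = ∀ k m → Feasible k m (chosen s k m) (value s k m)

    Bounded : ℕ → State → Set ℓ₂
    Bounded t s = ∀ k m → Bounds t k m (value s k m)

    bounds-mono : ∀ {t k m u v} → u ≤ᶠ v → Bounds t k m u → Bounds t k m v
    bounds-mono u≤v bounded S within ind size = ≤ᶠ-trans (bounded S within ind size) u≤v

    distinct : ∀ {k m l} → Left k l → Right m l → suc l ≢ k × suc l ≢ m
    distinct left right =
      (λ { refl → self-incompatible (left-compatible left) }) ,
      (λ { refl → self-incompatible (right-compatible right) })

    -- The table is updated in place, so later pairs of a round may read new values. This is
    -- harmless: values stay sound and only grow, and upper bounds survive growth. Only the visited
    -- pair advances to `suc t`.
    record Improved (t : ℕ) (k m : Boundary) (s s′ : State) : Set (ℓ₀ ⊔ℓ ℓ₁ ⊔ℓ ℓ₂) where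
      field
        sound   : Sound s′
        grows   : ∀ k′ m′ → value s k′ m′ ≤ᶠ value s′ k′ m′
        settled : Bounds (suc t) k m (value s′ k m)

    improve-ends : ∀ {s t k m} → Located k m s → Sound s → Bounded t s →
      Ends improve s (Improved t k m s)
    improve-ends {s} {t} {k} {m} located@(env , k≡ , m≡) sound bounded =
      search-ends {s} {k} {m} located andThen λ {s₁} f best → update s₁ f best (origin best)
      where
      same-value : ∀ {s₁} → Frame search s s₁ → ∀ k m → value s₁ k m ≡ value s k m
      same-value f k m = same-scalar f 6 refl _

      same-chosen : ∀ {s₁} → Frame search s s₁ → ∀ k m → chosen s₁ k m ≡ chosen s k m
      same-chosen {s₁} f k m = chosen-cong {s} {s₁} {k} {m} (λ i → same-int f 1 refl _)

      reflexive : ∀ {x y} → x ≡ y → x ≤ᶠ y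
      reflexive x≡y = ≤ᶠ-reflexive (Eq.reflexive x≡y)

      β-bounds : ∀ {b β} → BestBelow (value s) k m n b β → Bounds (suc t) k m β
      β-bounds best = bounds-step (value s) bounded (above best) (λ l → beats best l (toℕ<n l))

      unchanged : ∀ {s₁ S v k m} → Frame search s s₁ → S ≡ chosen s₁ k m → v ≡ value s₁ k m →
        Feasible k m S v
      unchanged {k = k} {m} f refl refl =
        subst₂ (Feasible k m) (sym (same-chosen f k m)) (sym (same-value f k m)) (sound k m)

      update : ∀ s₁ → Frame search s s₁ → BestBelow (value s) k m n (ints s₁ 8 0) (scalars s₁ 7 0) →
        (ints s₁ 8 0 ≡ 0 × scalars s₁ 7 0 ≡ value s k m) ⊎
        (∃[ l ] ints s₁ 8 0 ≡ suc (toℕ l) × Left k l × Right m l × scalars s₁ 7 0 ≡ candidate (value s) k m l) →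
        Ends save s₁ (Improved t k m s)
      update s₁ f best (inj₁ (b≡ , β≡)) = if-ends
        (λ _ → nop-ends record
          { sound   = λ k m → unchanged {s₁} f refl refl
          ; grows   = λ k m → reflexive (sym (same-value f k m))
          ; settled = subst (Bounds (suc t) k m) (trans β≡ (sym (same-value f k m))) (β-bounds best) })
        (λ ≢0 → contradiction (lift (≤-reflexive b≡)) ≢0)
      update s₁ f best (inj₂ (l , b≡ , left , right , β≡)) =
        save-ends {s₁} {k} {m} {l}
          (env-frame {s = s} {s₁} refl refl refl refl refl refl refl refl refl f env
          , trans (same-int f 5 refl 0) k≡ , trans (same-int f 6 refl 0) m≡)
          b≡ (proj₁ (distinct left right)) (proj₂ (distinct left right))
        implies λ {s₂} _ st → record
          { sound   = λ k′ m′ → sound′ s₂ st k′ m′ ((k′ ≟ꟳ k) ×-dec (m′ ≟ꟳ m))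
          ; grows   = λ k′ m′ → grows′ s₂ st k′ m′ ((k′ ≟ꟳ k) ×-dec (m′ ≟ꟳ m))
          ; settled = subst (Bounds (suc t) k m) (sym (stored st)) (β-bounds best) }
        where
        sound′ : ∀ s₂ → Stored k m l s₁ s₂ → ∀ k′ m′ → Dec (k′ ≡ k × m′ ≡ m) →
          Feasible k′ m′ (chosen s₂ k′ m′) (value s₂ k′ m′)
        sound′ s₂ st k′ m′ (yes (refl , refl)) =
          subst (Feasible k m (chosen s₂ k m)) (sym (trans (stored st) β≡))
            (feasible-join left right (sound k (suc l)) (sound (suc l) m)
              (subst₂ (λ A B → IsJoin l A B (chosen s₂ k m))
                (same-chosen f k (suc l)) (same-chosen f (suc l) m) (joined st)))
        sound′ s₂ st k′ m′ (no other) = unchanged {s₁} f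
          (chosen-cong {s₁} {s₂} {k′} {m′} (same-marks st k′ m′ other)) (same-values st k′ m′ other)

        grows′ : ∀ s₂ → Stored k m l s₁ s₂ → ∀ k′ m′ → Dec (k′ ≡ k × m′ ≡ m) →
          value s k′ m′ ≤ᶠ value s₂ k′ m′
        grows′ s₂ st k′ m′ (yes (refl , refl)) = ≤ᶠ-trans (above best) (reflexive (sym (stored st)))
        grows′ s₂ st k′ m′ (no other) =
          reflexive (sym (trans (same-values st k′ m′ other) (same-value f k′ m′)))

    Rounds : ℕ → State → Set (ℓ₀ ⊔ℓ ℓ₁ ⊔ℓ ℓ₂)
    Rounds t s = Env s × Sound s × Bounded t s

    Rows : ℕ → ℕ → State → Set (ℓ₀ ⊔ℓ ℓ₁ ⊔ℓ ℓ₂)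
    Rows t k s = Rounds t s × (∀ k′ → toℕ k′ < k → ∀ m → Bounds (suc t) k′ m (value s k′ m))

    Cells : ℕ → Boundary → ℕ → State → Set (ℓ₀ ⊔ℓ ℓ₁ ⊔ℓ ℓ₂)
    Cells t k m s = Rows t (toℕ k) s × ints s 5 0 ≡ toℕ k ×
                    (∀ m′ → toℕ m′ < m → Bounds (suc t) k m′ (value s k m′))

    cell-ends : ∀ {t k s} m → ints s 6 0 ≡ toℕ m → Cells t k (toℕ m) s →
      Ends improve s (Cells t k (suc (toℕ m)))
    cell-ends {t} {k} {s} m m≡ (((env , sound , bounded) , rows) , k≡ , cells) =
      improve-ends {s} {t} {k} {m} (env , k≡ , m≡) sound bounded implies λ {s′} f improved →
      ( ( env-frame {s = s} {s′} refl refl refl refl refl refl refl refl refl f env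
        , Improved.sound improved , λ k m → bounds-mono (Improved.grows improved k m) (bounded k m))
      , λ k′ k′< m → bounds-mono (Improved.grows improved k′ m) (rows k′ k′< m))
      , trans (same-int f 5 refl 0) k≡
      , below-suc {P = λ m → Bounds (suc t) k m (value s′ k m)}
          (λ m′ m′< → bounds-mono (Improved.grows improved k m′) (cells m′ m′<)) (Improved.settled improved)

    size-of : ∀ {s} → Env s → ints s 0 0 ≡ n
    size-of env = at-size (columns env)

    row-ends : ∀ {t s} k → ints s 5 0 ≡ toℕ k → Rows t (toℕ k) s →
      Ends (for 6 1 improve) s (Rows t (suc (toℕ k)))
    row-ends {t} {s} k k≡ rows@((env , _) , _) =
      for-ends (Cells t k) (size-of {s} env) refl refl refl id (rows , k≡ , λ _ ())
        (λ m {s′} _ m≡ cells → cell-ends {t} {k} {s′} m m≡ cells)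
      implies λ {s′} _ ((rounds , rows) , _ , cells) →
        rounds , below-suc {P = λ k → ∀ m → Bounds (suc t) k m (value s′ k m)} rows (λ m → cells m (toℕ<n m))

    round-ends : ∀ {t s} → Rounds t s → Ends (for 5 1 (for 6 1 improve)) s (Rounds (suc t))
    round-ends {t} {s} rounds@(env , _) =
      for-ends (Rows t) (size-of {s} env) refl refl refl id (rounds , λ _ ())
        (λ k {s′} _ k≡ rows → row-ends {t} {s′} k k≡ rows)
      implies λ _ ((env , sound , _) , rows) → env , sound , λ k m → rows k (toℕ<n k) m

    rounds-end : ∀ {s} → Rounds 0 s → Ends (for 4 0 (for 5 1 (for 6 1 improve))) s (Rounds n)
    rounds-end {s} rounds = for-ends Rounds (size-of {s} (proj₁ rounds)) refl refl refl id rounds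
      (λ t {s′} _ _ rounds → round-ends {toℕ t} {s′} rounds)

    -- Zeroed memory assigns every pair the empty set with value 0, the best among sets with no
    -- members.
    initial-rounds : ∀ {s} → Env s → (∀ j → ints s 1 j ≡ 0) → (∀ j → scalars s 6 j ≡ 0#) → Rounds 0 s
    initial-rounds {s} env no-marks no-values = env , sound , bounded
      where
      empty : ∀ k m i → i ∉ chosen s k m
      empty k m i i∈ = ∈-subset⁻ (marked? s k m) i∈ (no-marks _)

      sound : Sound s
      sound k m = record
        { within = λ i∈ → contradiction i∈ (empty k m _)
        ; independent = λ i _ i∈ → contradiction i∈ (empty k m i)
        ; weighs = Eq.trans (weight-empty I (empty k m)) (Eq.reflexive (sym (no-values _))) }

      bounded : Bounded 0 s
      bounded k m S _ _ size = ≤ᶠ-reflexive (Eq.trans (weight-empty I none) (Eq.reflexive (sym (no-values _))))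
        where
        none : ∀ i → i ∉ S
        none i i∈S = contradiction (≤-trans (≤-reflexive (sym (∣⁅x⁆∣≡1 i)))
          (≤-trans (p⊆q⇒∣p∣≤∣q∣ (λ j∈ → subst (_∈ S) (sym (x∈⁅y⁆⇒x≡y i j∈)) i∈S)) size)) λ ()

    -- No set has more than `n` members, so after `n` rounds the limit on cardinality is void. The
    -- cells of `(zero , zero)` start at 0, which makes its chosen set equal to `output n s` by
    -- computation.
    rounds-optimal : ∀ {s} → Rounds n s → IsMaxWeightIndependent I (output n s)
    rounds-optimal {s} (_ , sound , bounded) = record
      { independent = independent (sound zero zero)
      ; maximal = λ S ind → ≤ᶠ-trans (bounded zero zero S (λ _ → tt , tt) ind (∣p∣≤n S))
          (≤ᶠ-reflexive (Eq.sym (weighs (sound zero zero)))) }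

  solve-solves : EachVisibleFromAbove I → SolvesWithin (compile solve) I (time solve n)
  solve-solves visible = steps done , final done , run done , bound done , post done
    where
    done : Ends solve (input I) (λ s → IsMaxWeightIndependent I (output n s))
    done = findAnchors-ends visible {input I} input-inputs andThen λ {s₁} f₁ anchored →
      multiples-ends 2 (var 0 ⊕ const 1) (suc n) {s₁} refl refl refl
        (same-int f₁ 0 refl 0) (same-int f₁ 2 refl 0)
        (λ g → trans (cong (_+ 1) (trans (same-int g 0 refl 0) (same-int f₁ 0 refl 0))) (+-comm n 1))
      andThen λ {s₂} f₂ rows →
      multiples-ends 3 (intAt 2 (var 0 ⊕ const 1)) (suc n * suc n) {s₂} refl refl refl
        (trans (same-int f₂ 0 refl 0) (same-int f₁ 0 refl 0)) (trans (same-int f₂ 3 refl 0) (same-int f₁ 3 refl 0))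
        -- Cell `n + 1` of array 2 holds the square of `n + 1`.
        (λ {s′} g → trans (same-int g 2 refl _) (trans (cong (ints s₂ 2) (trans (+-comm _ 1)
          (cong suc (trans (same-int g 0 refl 0) (trans (same-int f₂ 0 refl 0) (same-int f₁ 0 refl 0))))))
          (rows (suc n) ≤-refl)))
      andThen λ {s₃} f₃ blocks →
      -- The anchors are fixed as those found in `s₁`; later commands do not write scalar array 5.
      let open Table (λ i → scalars s₁ 5 (toℕ i)) anchored
          inputs₁ = inputs-frame {s = input I} {s₁} refl refl refl refl refl refl f₁ input-inputs
          inputs₂ = inputs-frame {s = s₁} {s₂} refl refl refl refl refl refl f₂ inputs₁
          inputs₃ = inputs-frame {s = s₂} {s₃} refl refl refl refl refl refl f₃ inputs₂
          env : Env s₃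
          env = record
            { columns   = inputs₃
            ; at-anchor = λ { {j} refl → trans (same-scalar f₃ 5 refl _) (same-scalar f₂ 5 refl _) }
            ; at-row    = λ m → trans (same-int f₃ 2 refl _) (rows (toℕ m) (<⇒≤ (toℕ<n m)))
            ; at-block  = λ k → blocks (toℕ k) (<⇒≤ (toℕ<n k)) }
      in rounds-end {s₃} (initial-rounds {s₃} env
           (λ j → trans (same-int f₃ 1 refl j) (trans (same-int f₂ 1 refl j) (same-int f₁ 1 refl j)))
           (λ j → trans (same-scalar f₃ 6 refl j) (trans (same-scalar f₂ 6 refl j) (same-scalar f₁ 6 refl j))))
         implies λ {s₄} _ → rounds-optimal {s₄}

theorem4p19 : ∀ {c ℓ₁ ℓ₂} → ∃[ p ] ∃[ T ] (T ∈O (λ n → n ^ 4)) ×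
    ((R : OrderedField c ℓ₁ ℓ₂) → let open MWISR R in
    ∀ (n : ℕ) (I : Instance n) → EachVisibleFromAbove I → SolvesWithin p I (T n))
-- The deepest nest consists of the rounds, two boundaries and a scan of the rectangles, so
-- `depth solve` computes to 4.
theorem4p19 = compile solve , time solve , time∈O solve , λ R n I → Solver.solve-solves R I
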